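{- Given an oracle for satisfiability modulo $\mathit{Th}$, $\mathrm{RecMC}$ is a co-semidecision procedure for safety, i.e. it is guaranteed to find a counterexample if one exists: for every program $\mathcal{A}$ with main procedure $M$ and every safety property $\varphi_{\mathrm{safe}}$ of $M$, if $M\not\models\varphi_{\mathrm{safe}}$ then $\mathrm{RecMC}(\mathcal{A},\varphi_{\mathrm{safe}})$ terminates and returns UNSAFE.
   Context: **Logic.** Fix a first-order language with equality with signature $\mathcal{S}$ (non-logical symbols) and an $\mathcal{S}$-theory $\mathit{Th}$ (a deductively closed set of $\mathcal{S}$-sentences). For an $\mathcal{S}$-formula $\psi$, $\models\psi$ means that $\psi$ holds in every model of $\mathit{Th}$ under every assignment of its free variables, and $\not\models\psi$ is its negation. The oracle decides satisfiability modulo $\mathit{Th}$, so all tests below can be decided. For an $\mathcal{S}$-structure $I$ with domain $|I|$ and a formula $\varphi(\bar x)$, $I(\varphi)$ is the set of $\bar a\in|I|^{|\bar x|}$ satisfying $\varphi$ in $I$ (a truth value if $\bar x$ is empty, with true identified with $|I|$ and false with $\emptyset$). **Programs.** A program $\mathcal{A}=\langle P_0,\dots,P_m\rangle$ is a finite list of procedures with a designated main procedure $M$. A procedure $P$ is a tuple $\langle\bar\iota_P,\bar o_P,\Sigma_P,\bar\ell_P,\beta_P\rangle$: finite lists of input variables $\bar\iota_P$, output variables $\bar o_P$ and local variables $\bar\ell_P$; a fresh predicate symbol $\Sigma_P$ of arity $|\bar\iota_P|+|\bar o_P|$; and a body $\beta_P$, a quantifier-free formula over $\mathcal{S}\cup\{\Sigma_Q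 : Q\in\mathcal{A}\}$ with variables among $\bar\iota_P,\bar o_P,\bar\ell_P$, in which every $\Sigma_Q$ occurs only positively. Put $\bar v_P=\bar\iota_P\cup\bar o_P$. $\mathit{Paths}(P)$ is the set of prime implicants (conjunctions of literals) of $\beta_P$. **Semantics.** For an $\mathcal{S}$-structure $I$ and a list $\bar X=\langle X_0,\dots,X_m\rangle$ with $X_i\subseteq|I|^{|\bar v_{P_i}|}$ (a truth value if $|\bar v_{P_i}|=0$), $J(I,\bar X)$ is the expansion of $I$ interpreting each $\Sigma_{P_i}$ as $X_i$. $\langle[\![P_0]\!]_I,\dots,[\![P_m]\!]_I\rangle$ is the pointwise least $\bar X$ such that $J(I,\bar X)\models\forall\bar v_Q\cup\bar\ell_Q\,(\beta_Q\Rightarrow\Sigma_Q(\bar v_Q))$ for all $Q\in\mathcal{A}$. A safety property of $P$ is a formula $\varphi$ over $\bar v_P$; $P\models\varphi$ iff $[\![P]\!]_I\subseteq I(\varphi)$ for all models $I$ of $\mathit{Th}$. **Maps.** A bounded assertion map $m$ maps each pair (procedure $P$, natural number $b$) to a set of formulas over $\bar v_P$; $m\cup\{\langle P,b\rangle\mapsto\psi\}$ adds $\psi$ to $m(P,b)$; $\emptyset$ is the map with all values empty. For $b\ge0$, $U^b_m(\Sigma_P)=\bigvee\{\delta\in m(P,b') : b'\le b\}$ and $O^b_m(\Sigma_P)=\bigwedge\{\delta\in m(P,b') : b'\ge b\}$ (empty disjunction $\bot$, empty conjunction $\top$); $U^{ -1}_m$ and $O^{ -1}_m$ map every $\Sigma_P$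 to $\bot$. For a formula $\tau$, $[\![\tau]\!]^b_\rho$ (resp. $[\![\tau]\!]^b_\sigma$) is $\tau$ with every $\Sigma_P$ instantiated by $U^b_\rho(\Sigma_P)$ (resp. $O^b_\sigma(\Sigma_P)$); $[\![\Sigma_P]\!]$ abbreviates $[\![\Sigma_P(\bar v_P)]\!]$. **$\mathrm{BndSafety}(\mathcal{A},\varphi_{\mathrm{safe}},n,\rho_{\mathrm{Init}},\sigma_{\mathrm{Init}})$** is a nondeterministic transition system. States are triples $\mathcal{Q}\parallel\rho\parallel\sigma$ with bounded assertion maps $\rho$ (reachability facts), $\sigma$ (summary facts) and a set $\mathcal{Q}$ of queries $\langle P,\varphi,b\rangle$ ($P$ a procedure, $\varphi$ a formula over $\bar v_P$, $b\ge0$). Rules: - Init: the initial state is $\{\langle M,\neg\varphi_{\mathrm{safe}},n\rangle\}\parallel\rho_{\mathrm{Init}}\parallel\sigma_{\mathrm{Init}}$. - Sum: if $\langle P,\varphi,b\rangle\in\mathcal{Q}$ and $\models[\![\beta_P]\!]^{b-1}_\sigma\Rightarrow\neg\varphi$, choose an interpolant $\psi$, i.e. a formula over $\bar v_P$ with $\models[\![\beta_P]\!]^{b-1}_\sigma\Rightarrow\psi$ and $\models\psi\Rightarrow\neg\varphi$; add $\langle P,b\rangle\mapsto\psi$ to $\sigma$ and remove from $\mathcal{Q}$ all $\langle P,\eta,c\rangle$ with $c\le b$ and $\models[\![\Sigma_P]\!]^c_\sigma\wedge\psi\Rightarrow\neg\eta$ (with the old $\sigma$). - Reach: if $\langle P,\varphi,b\rangle\in\mathcal{Q}$,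 $\pi\in\mathit{Paths}(P)$ and $\not\models[\![\pi]\!]^{b-1}_\rho\Rightarrow\neg\varphi$, let $\psi=\exists\bar\ell_P.[\![\pi]\!]^{b-1}_\rho$; add $\langle P,b\rangle\mapsto\psi$ to $\rho$ and remove from $\mathcal{Q}$ all $\langle P,\eta,c\rangle$ with $c\ge b$ and $\not\models\psi\Rightarrow\neg\eta$. - Query: if $\langle P,\varphi,b\rangle\in\mathcal{Q}$, $\models[\![\beta_P]\!]^{b-1}_\rho\Rightarrow\neg\varphi$, $\pi\in\mathit{Paths}(P)$, $\pi=\pi_u\wedge\Sigma_R(\bar a)\wedge\pi_v$ (a prefix, a call, a suffix), $\models[\![\pi_u]\!]^{b-1}_\sigma\wedge[\![\Sigma_R(\bar a)]\!]^{b-1}_\rho\wedge[\![\pi_v]\!]^{b-1}_\rho\Rightarrow\neg\varphi$ and $\not\models[\![\pi_u]\!]^{b-1}_\sigma\wedge[\![\Sigma_R(\bar a)]\!]^{b-1}_\sigma\wedge[\![\pi_v]\!]^{b-1}_\rho\Rightarrow\neg\varphi$, let $\psi=(\exists(\bar v_P\cup\bar\ell_P)\setminus\bar a.\ [\![\pi_u]\!]^{b-1}_\sigma\wedge[\![\pi_v]\!]^{b-1}_\rho\wedge\varphi)[\bar a\leftarrow\bar v_R]$; if $\models\psi\Rightarrow\neg\eta$ for all $\langle R,\eta,b-1\rangle\in\mathcal{Q}$, add $\langle R,\psi,b-1\rangle$ to $\mathcal{Q}$. - Unsafe: if $\mathcal{Q}=\emptyset$ and $\not\models[\![\Sigma_M]\!]^n_\rho\Rightarrow\varphi_{\mathrm{safe}}$,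 return UNSAFE. - Safe: if $\mathcal{Q}=\emptyset$ and $\models[\![\Sigma_M]\!]^n_\sigma\Rightarrow\varphi_{\mathrm{safe}}$, return SAFE. **$\mathrm{RecMC}(\mathcal{A},\varphi_{\mathrm{safe}})$.** Start with $n=0$, $\rho=\sigma=\emptyset$ and loop: run $\mathrm{BndSafety}(\mathcal{A},\varphi_{\mathrm{safe}},n,\rho,\sigma)$ and update $\rho,\sigma$ to its final maps. If it returns UNSAFE, return UNSAFE. Otherwise run CheckInductive: for each $P\in\mathcal{A}$ and $\delta\in\sigma(P,n)$, if $\models[\![\beta_P]\!]^n_\sigma\Rightarrow\delta$ then add $\langle P,n+1\rangle\mapsto\delta$ to $\sigma$; CheckInductive succeeds iff this test succeeds for all such $P,\delta$. If it succeeds return SAFE; otherwise set $n:=n+1$ and repeat. -}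

module Defs where

open import Axiom.ExcludedMiddle using (ExcludedMiddle)
open import Data.Bool.Base using (Bool; true; false; T; not; _∧_; _∨_)
open import Data.Empty using (⊥)
import Data.Empty.Polymorphic as Poly
open import Data.Fin.Base using (Fin; zero; suc; _↑ˡ_; _↑ʳ_)
import Data.Fin.Properties as Fin
open import Data.List.Base using (List; []; _∷_; _++_; map; filter; foldr)
open import Data.List.Membership.Propositional using (_∈_)
open import Data.List.Relation.Binary.Sublist.Propositional using () renaming (_⊆_ to _⊑_)
open import Data.List.Relation.Unary.All using (All)
open import Data.Maybe.Base using (Maybe; just; nothing)
open import Data.Nat.Base using (ℕ; zero; suc; _+_; _≤_; _≥_)
import Data.Nat.Properties as ℕ
open import Data.Product.Base using (Σ-syntax; ∃-syntax; _×_; _,_; proj₁; proj₂)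
open import Data.Sum.Base using (_⊎_; inj₁; inj₂; [_,_]′)
open import Data.Unit.Base using (⊤)
open import Data.Vec.Base as Vec using (Vec; []; _∷_; lookup; tabulate)
open import Function.Base using (_∘_; flip)
open import Induction.WellFounded using (Acc)
open import Level using (Level; Lift; lift; lower; _⊔_) renaming (suc to lsuc)
open import Relation.Binary.Construct.Closure.ReflexiveTransitive using (Star)
open import Relation.Binary.PropositionalEquality using (_≡_; refl)
open import Relation.Binary.Rewriting using (IsNormalForm)
open import Relation.Nullary.Decidable using (Dec; yes; no; True; toWitness; fromWitness; ¬?)
open import Relation.Nullary.Negation using (¬_; contradiction)
open import Relation.Unary using (Pred) renaming (_∈_ to _∈ᴾ_; _⊆_ to _⊆ᴾ_)

private
  variable
    s ℓ t : Level
    m n : ℕ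

record Symbols (s : Level) : Set (lsuc s) where
  field
    Symbol : Set s
    arity  : Symbol → ℕ

open Symbols

record Signature (s : Level) : Set (lsuc s) where
  field
    functions  : Symbols s
    predicates : Symbols s

open Signature

-- Terms and formulas are indexed by the number of variables in scope;
-- variables are de Bruijn indices.
data Term (F : Symbols s) (n : ℕ) : Set s where
  var : Fin n → Term F n
  fun : (f : Symbol F) → Vec (Term F n) (arity F f) → Term F n

data Atom (S : Signature s) (n : ℕ) : Set s where
  _≐_ : Term (functions S) n → Term (functions S) n → Atom S n
  rel : (r : Symbol (predicates S)) →
        Vec (Term (functions S) n) (arity (predicates S) r) → Atom S n

infix  8 _≐_
infixr 6 _∧′_
infixr 5 _∨′_
infixr 4 _⇒′_
infix  7 ¬′_

data Formula (S : Signature s) (n : ℕ) : Set s where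
  atom           : Atom S n → Formula S n
  ⊥′             : Formula S n
  _∧′_ _∨′_ _⇒′_ : Formula S n → Formula S n → Formula S n
  ∀′ ∃′          : Formula S (suc n) → Formula S n

⊤′ : {S : Signature s} → Formula S n
⊤′ = ⊥′ ⇒′ ⊥′

¬′_ : {S : Signature s} → Formula S n → Formula S n
¬′ φ = φ ⇒′ ⊥′

⋀ ⋁ : {S : Signature s} → List (Formula S n) → Formula S n
⋀ = foldr _∧′_ ⊤′
⋁ = foldr _∨′_ ⊥′

-- Binds the first k variables.
∃ⁿ : {S : Signature s} (k : ℕ) → Formula S (k + n) → Formula S n
∃ⁿ zero    φ = φ
∃ⁿ (suc k) φ = ∃ⁿ k (∃′ φ)

module _ {F : Symbols s} where

  infixl 30 _[_]ᵗ _[_]ᵗˢ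

  mutual
    _[_]ᵗ : Term F m → Vec (Term F n) m → Term F n
    var i    [ us ]ᵗ = lookup us i
    fun f ts [ us ]ᵗ = fun f (ts [ us ]ᵗˢ)

    _[_]ᵗˢ : ∀ {k} → Vec (Term F m) k → Vec (Term F n) m → Vec (Term F n) k
    []       [ us ]ᵗˢ = []
    (t ∷ ts) [ us ]ᵗˢ = t [ us ]ᵗ ∷ ts [ us ]ᵗˢ

  vars : (Fin m → Fin n) → Vec (Term F n) m
  vars f = tabulate (var ∘ f)

  underBinder : Vec (Term F n) m → Vec (Term F (suc n)) (suc m)
  underBinder us = var zero ∷ us [ vars suc ]ᵗˢ

module _ {S : Signature s} where

  infixl 30 _[_]

  _[_] : Formula S m → Vec (Term (functions S) n) m → Formula S n
  atom (t ≐ u)    [ us ] = atom (t [ us ]ᵗ ≐ u [ us ]ᵗ)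
  atom (rel r ts) [ us ] = atom (rel r (ts [ us ]ᵗˢ))
  ⊥′              [ us ] = ⊥′
  (φ ∧′ ψ)        [ us ] = φ [ us ] ∧′ ψ [ us ]
  (φ ∨′ ψ)        [ us ] = φ [ us ] ∨′ ψ [ us ]
  (φ ⇒′ ψ)        [ us ] = φ [ us ] ⇒′ ψ [ us ]
  ∀′ φ            [ us ] = ∀′ (φ [ underBinder us ])
  ∃′ φ            [ us ] = ∃′ (φ [ underBinder us ])

record Algebra (F : Symbols s) (ℓ : Level) : Set (s ⊔ lsuc ℓ) where
  field
    Carrier    : Set ℓ
    inhabitant : Carrier
    ⟦fun⟧      : (f : Symbol F) → Vec Carrier (arity F f) → Carrier

record Structure (S : Signature s) (ℓ : Level) : Set (s ⊔ lsuc ℓ) where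
  field
    algebra : Algebra (functions S) ℓ
  open Algebra algebra public
  field
    ⟦rel⟧ : (r : Symbol (predicates S)) → Vec Carrier (arity (predicates S) r) → Set ℓ

open Structure using (algebra; Carrier; ⟦rel⟧)

module _ {F : Symbols s} (A : Algebra F ℓ) (ρ : Vec (Algebra.Carrier A) n) where

  mutual
    eval : Term F n → Algebra.Carrier A
    eval (var i)    = lookup ρ i
    eval (fun f ts) = Algebra.⟦fun⟧ A f (evals ts)

    evals : ∀ {k} → Vec (Term F n) k → Vec (Algebra.Carrier A) k
    evals []       = []
    evals (t ∷ ts) = eval t ∷ evals ts

-- Sat I φ is the set I(φ).
Sat : {S : Signature s} (I : Structure S ℓ) → Formula S n → Pred (Vec (Carrier I) n) ℓ
Sat I (atom (t ≐ u))    ρ = eval (algebra I) ρ t ≡ eval (algebra I) ρ u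
Sat I (atom (rel r ts)) ρ = ⟦rel⟧ I r (evals (algebra I) ρ ts)
Sat I ⊥′                ρ = Poly.⊥
Sat I (φ ∧′ ψ)          ρ = Sat I φ ρ × Sat I ψ ρ
Sat I (φ ∨′ ψ)          ρ = Sat I φ ρ ⊎ Sat I ψ ρ
Sat I (φ ⇒′ ψ)          ρ = Sat I φ ρ → Sat I ψ ρ
Sat I (∀′ φ)            ρ = ∀ d → Sat I φ (d ∷ ρ)
Sat I (∃′ φ)            ρ = ∃[ d ] Sat I φ (d ∷ ρ)

-- Truth of the universal closure.
_⊩_ : {S : Signature s} (I : Structure S ℓ) → Formula S n → Set ℓ
I ⊩ φ = ∀ ρ → Sat I φ ρ

Sentence : Signature s → Set s
Sentence S = Formula S 0

IsModel : {S : Signature s} → Pred (Sentence S) t → Structure S ℓ → Set (s ⊔ ℓ ⊔ t)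
IsModel Th I = ∀ θ → θ ∈ᴾ Th → I ⊩ θ

-- Models are the structures living in the universe Set ℓ; deductive closure
-- is closure under semantic consequence over those.
record Theory (S : Signature s) (ℓ t : Level) : Set (s ⊔ lsuc (ℓ ⊔ t)) where
  field
    sentences : Pred (Sentence S) t
    closed    : ∀ θ → (∀ (I : Structure S ℓ) → IsModel sentences I → I ⊩ θ) →
                θ ∈ᴾ sentences

open Theory

module _ {S : Signature s} (Th : Theory S ℓ t) where

  Valid : Formula S n → Set (s ⊔ lsuc ℓ ⊔ t)
  Valid φ = ∀ (I : Structure S ℓ) → IsModel (sentences Th) I → I ⊩ φ

  Satisfiable : Formula S n → Set (s ⊔ lsuc ℓ ⊔ t)
  Satisfiable φ =
    Σ[ I ∈ Structure S ℓ ] IsModel (sentences Th) I × (∃[ ρ ] Sat I φ ρ)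

  Oracle : Set (s ⊔ lsuc ℓ ⊔ t)
  Oracle = ∀ {n} (φ : Formula S n) → Dec (Satisfiable φ)

  ValidityTest : Set (s ⊔ lsuc ℓ ⊔ t)
  ValidityTest = ∀ {n} (φ : Formula S n) → Dec (Valid φ)

  validityTest : ExcludedMiddle ℓ → Oracle → ValidityTest
  validityTest em sat? φ with sat? (¬′ φ)
  ... | yes (I , mod , ρ , ¬φ) = no λ valid → contradiction (¬φ (valid I mod ρ)) λ ()
  ... | no unsat = yes valid
    where
    valid : Valid φ
    valid I mod ρ with em {Sat I φ ρ}
    ... | yes φρ = φρ
    ... | no ¬φρ =
      contradiction (I , mod , ρ , λ φρ → contradiction φρ ¬φρ) unsat

QuantifierFree : {S : Signature s} → Formula S n → Set
QuantifierFree (atom _) = ⊤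
QuantifierFree ⊥′       = ⊤
QuantifierFree (φ ∧′ ψ) = QuantifierFree φ × QuantifierFree ψ
QuantifierFree (φ ∨′ ψ) = QuantifierFree φ × QuantifierFree ψ
QuantifierFree (φ ⇒′ ψ) = QuantifierFree φ × QuantifierFree ψ
QuantifierFree (∀′ _)   = ⊥
QuantifierFree (∃′ _)   = ⊥

data Literal (S : Signature s) (n : ℕ) : Set s where
  pos neg : Atom S n → Literal S n

literal : {S : Signature s} → Literal S n → Formula S n
literal (pos a) = atom a
literal (neg a) = ¬′ atom a

conj : {S : Signature s} → List (Literal S n) → Formula S n
conj = ⋀ ∘ map literal

-- Prime implicants are taken propositionally: atoms, equations included, are
-- treated as independent propositional variables.
module _ {S : Signature s} where

  Valuation : ℕ → Set s
  Valuation n = Atom S n → Bool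

  truth : Valuation n → (φ : Formula S n) → QuantifierFree φ → Bool
  truth v (atom a) _         = v a
  truth v ⊥′       _         = false
  truth v (φ ∧′ ψ) (qφ , qψ) = truth v φ qφ ∧ truth v ψ qψ
  truth v (φ ∨′ ψ) (qφ , qψ) = truth v φ qφ ∨ truth v ψ qψ
  truth v (φ ⇒′ ψ) (qφ , qψ) = not (truth v φ qφ) ∨ truth v ψ qψ

  Makes_True : Valuation n → Literal S n → Set
  Makes v True (pos a) = T (v a)
  Makes v True (neg a) = T (not (v a))

  -- A term is a consistent conjunction of literals, hence the first component.
  Implicant : (φ : Formula S n) → QuantifierFree φ → List (Literal S n) → Set s
  Implicant φ qf π =
    (∃[ v ] All Makes v True π) ×
    (∀ v → All Makes v True π → T (truth v φ qf))

  -- Conjunctions are lists, so every ordering of the literals of a prime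
  -- implicant counts; minimality rules out repeated literals.
  PrimeImplicant : (φ : Formula S n) → QuantifierFree φ → List (Literal S n) → Set s
  PrimeImplicant φ qf π =
    Implicant φ qf π × (∀ π′ → π′ ⊑ π → Implicant φ qf π′ → π′ ≡ π)

_⊕_ : Signature s → {k : ℕ} → (Fin k → ℕ) → Signature s
functions  (S ⊕ ar) = functions S
predicates (S ⊕ ar) = record
  { Symbol = Symbol (predicates S) ⊎ Fin _
  ; arity  = [ arity (predicates S) , ar ]′
  }

module _ {S : Signature s} {k : ℕ} {ar : Fin k → ℕ} where

  mutual
    CallsPositive : Formula (S ⊕ ar) n → Set
    CallsPositive (atom _) = ⊤
    CallsPositive ⊥′       = ⊤
    CallsPositive (φ ∧′ ψ) = CallsPositive φ × CallsPositive ψ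
    CallsPositive (φ ∨′ ψ) = CallsPositive φ × CallsPositive ψ
    CallsPositive (φ ⇒′ ψ) = CallsNegative φ × CallsPositive ψ
    CallsPositive (∀′ φ)   = CallsPositive φ
    CallsPositive (∃′ φ)   = CallsPositive φ

    CallsNegative : Formula (S ⊕ ar) n → Set
    CallsNegative (atom (_ ≐ _))          = ⊤
    CallsNegative (atom (rel (inj₁ _) _)) = ⊤
    CallsNegative (atom (rel (inj₂ _) _)) = ⊥
    CallsNegative ⊥′                      = ⊤
    CallsNegative (φ ∧′ ψ)                = CallsNegative φ × CallsNegative ψ
    CallsNegative (φ ∨′ ψ)                = CallsNegative φ × CallsNegative ψ
    CallsNegative (φ ⇒′ ψ)                = CallsPositive φ × CallsNegative ψ
    CallsNegative (∀′ φ)                  = CallsNegative φ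
    CallsNegative (∃′ φ)                  = CallsNegative φ

  -- Replaces every call Σ_Q(ā) by Φ Q with ā for its variables.
  instantiate : (∀ Q → Formula S (ar Q)) → Formula (S ⊕ ar) n → Formula S n
  instantiate Φ (atom (t ≐ u))           = atom (t ≐ u)
  instantiate Φ (atom (rel (inj₁ r) ts)) = atom (rel r ts)
  instantiate Φ (atom (rel (inj₂ Q) ts)) = Φ Q [ ts ]
  instantiate Φ ⊥′                       = ⊥′
  instantiate Φ (φ ∧′ ψ)                 = instantiate Φ φ ∧′ instantiate Φ ψ
  instantiate Φ (φ ∨′ ψ)                 = instantiate Φ φ ∨′ instantiate Φ ψ
  instantiate Φ (φ ⇒′ ψ)                 = instantiate Φ φ ⇒′ instantiate Φ ψ
  instantiate Φ (∀′ φ)                   = ∀′ (instantiate Φ φ)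
  instantiate Φ (∃′ φ)                   = ∃′ (instantiate Φ φ)

-- The variable lists of a procedure are disjoint and given by their lengths.
-- The variables of a body are the locals, then the inputs, then the outputs.
record Program (S : Signature s) : Set s where
  field
    last                : ℕ
    ins outs locals     : Fin (suc last) → ℕ

  Proc : Set
  Proc = Fin (suc last)

  ∣v∣ : Proc → ℕ
  ∣v∣ P = ins P + outs P

  ∣vℓ∣ : Proc → ℕ
  ∣vℓ∣ P = locals P + ∣v∣ P

  field
    main           : Proc
    body           : ∀ P → Formula (S ⊕ ∣v∣) (∣vℓ∣ P)
    quantifierFree : ∀ P → QuantifierFree (body P)
    callsPositive  : ∀ P → CallsPositive (body P)

  Path : Proc → Set s
  Path P = List (Literal (S ⊕ ∣v∣) (∣vℓ∣ P))

  Paths : ∀ P → Pred (Path P) s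
  Paths P = PrimeImplicant (body P) (quantifierFree P)

  call : ∀ R → Vec (Term (functions S) n) (∣v∣ R) → Atom (S ⊕ ∣v∣) n
  call R as = rel (inj₂ R) as

  -- A formula over v_P, seen as one over the variables of the body of P.
  _↑ : ∀ {P} → Formula S (∣v∣ P) → Formula S (∣vℓ∣ P)
  _↑ {P} φ = φ [ vars (locals P ↑ʳ_) ]

module Semantics {S : Signature s} (𝒜 : Program S) where
  open Program 𝒜

  Interpretation : Structure S ℓ → Set (lsuc ℓ)
  Interpretation {ℓ = ℓ} I = ∀ P → Pred (Vec (Carrier I) (∣v∣ P)) ℓ

  J : (I : Structure S ℓ) → Interpretation I → Structure (S ⊕ ∣v∣) ℓ
  algebra (J I X) = algebra I
  ⟦rel⟧ (J I X) (inj₁ r) = ⟦rel⟧ I r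
  ⟦rel⟧ (J I X) (inj₂ P) = X P

  Closed : (I : Structure S ℓ) → Interpretation I → Set ℓ
  Closed I X = ∀ Q → J I X ⊩ (body Q ⇒′ atom (call Q (vars (locals Q ↑ʳ_))))

  IsLeast : (I : Structure S ℓ) → Interpretation I → Set (lsuc ℓ)
  IsLeast I X = Closed I X × (∀ Y → Closed I Y → ∀ P → X P ⊆ᴾ Y P)

  -- P ⊨ φ.  The least interpretation exists and is unique up to equivalence
  -- (see least-exists below), so quantifying over it is no restriction.
  Safe : Theory S ℓ t → (P : Proc) → Formula S (∣v∣ P) → Set (s ⊔ lsuc ℓ ⊔ t)
  Safe {ℓ = ℓ} Th P φ =
    ∀ (I : Structure S ℓ) → IsModel (sentences Th) I →
    ∀ ⟦𝒜⟧ → IsLeast I ⟦𝒜⟧ → ⟦𝒜⟧ P ⊆ᴾ Sat I φ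

  module _ (I : Structure S ℓ) {X Y : Interpretation I} (X⊆Y : ∀ P → X P ⊆ᴾ Y P) where

    mutual
      monotone : ∀ (φ : Formula (S ⊕ ∣v∣) n) → CallsPositive φ → Sat (J I X) φ ⊆ᴾ Sat (J I Y) φ
      monotone (atom (t ≐ u))           _         h        = h
      monotone (atom (rel (inj₁ r) ts)) _         h        = h
      monotone (atom (rel (inj₂ P) ts)) _         h        = X⊆Y P h
      monotone (φ ∧′ ψ)                 (cφ , cψ) (h , h′) = monotone φ cφ h , monotone ψ cψ h′
      monotone (φ ∨′ ψ)                 (cφ , cψ) (inj₁ h) = inj₁ (monotone φ cφ h)
      monotone (φ ∨′ ψ)                 (cφ , cψ) (inj₂ h) = inj₂ (monotone ψ cψ h)
      monotone (φ ⇒′ ψ)                 (cφ , cψ) h        = λ a → monotone ψ cψ (h (antitone φ cφ a))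
      monotone (∀′ φ)                   c         h        = λ d → monotone φ c (h d)
      monotone (∃′ φ)                   c         (d , h)  = d , monotone φ c h

      antitone : ∀ (φ : Formula (S ⊕ ∣v∣) n) → CallsNegative φ → Sat (J I Y) φ ⊆ᴾ Sat (J I X) φ
      antitone (atom (t ≐ u))           _         h        = h
      antitone (atom (rel (inj₁ r) ts)) _         h        = h
      antitone (φ ∧′ ψ)                 (cφ , cψ) (h , h′) = antitone φ cφ h , antitone ψ cψ h′
      antitone (φ ∨′ ψ)                 (cφ , cψ) (inj₁ h) = inj₁ (antitone φ cφ h)
      antitone (φ ∨′ ψ)                 (cφ , cψ) (inj₂ h) = inj₂ (antitone ψ cψ h)
      antitone (φ ⇒′ ψ)                 (cφ , cψ) h        = λ a → antitone ψ cψ (h (monotone φ cφ a))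
      antitone (∀′ φ)                   c         h        = λ d → antitone φ c (h d)
      antitone (∃′ φ)                   c         (d , h)  = d , antitone φ c h

  -- The intersection of all closed interpretations; excluded middle brings
  -- it down to the universe of I.
  least-exists : ExcludedMiddle (lsuc ℓ) → (I : Structure S ℓ) → ∃[ X ] IsLeast I X
  least-exists {ℓ = ℓ} em I = X , closed-X , least
    where
    X : Interpretation I
    X P a = Lift ℓ (True (em {∀ Y → Closed I Y → Y P a}))

    least : ∀ Y → Closed I Y → ∀ P → X P ⊆ᴾ Y P
    least Y closed-Y P (lift w) = toWitness w Y closed-Y

    closed-X : Closed I X
    closed-X Q ρ h = lift (fromWitness λ Y closed-Y →
      closed-Y Q ρ (monotone I (least Y closed-Y) (body Q) (callsPositive Q) h))

-- nothing stands for the bound −1.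
_⊖1 : ℕ → Maybe ℕ
zero  ⊖1 = nothing
suc b ⊖1 = just b

module Maps {S : Signature s} (𝒜 : Program S) where
  open Program 𝒜

  -- A finite map; (b , ψ) occurs in the list of P when ψ belongs to m(P,b).
  Map : Set s
  Map = ∀ P → List (ℕ × Formula S (∣v∣ P))

  ∅ : Map
  ∅ _ = []

  _at_ : Map → ℕ → ∀ P → List (Formula S (∣v∣ P))
  (m at b) P = map proj₂ (filter ((ℕ._≟ b) ∘ proj₁) (m P))

  add : Map → (P : Proc) → ℕ → Formula S (∣v∣ P) → Map
  add m P b ψ Q with P Fin.≟ Q
  ... | yes refl = (b , ψ) ∷ m Q
  ... | no _     = m Q

  U O : Map → Maybe ℕ → ∀ P → Formula S (∣v∣ P)
  U m nothing  P = ⊥′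
  U m (just b) P = ⋁ (map proj₂ (filter ((ℕ._≤? b) ∘ proj₁) (m P)))
  O m nothing  P = ⊥′
  O m (just b) P = ⋀ (map proj₂ (filter ((b ℕ.≤?_) ∘ proj₁) (m P)))

data Verdict : Set where
  SAFE UNSAFE : Verdict

module Algorithms
  {S : Signature s} (Th : Theory S ℓ t) (valid? : ValidityTest Th)
  (𝒜 : Program S) (φ-safe : Formula S (Program.∣v∣ 𝒜 (Program.main 𝒜)))
  where

  open Program 𝒜
  open Maps 𝒜

  infix 1 ⊨_ ⊭_

  ⊨_ ⊭_ : Formula S n → Set (s ⊔ lsuc ℓ ⊔ t)
  ⊨ φ = Valid Th φ
  ⊭ φ = ¬ (⊨ φ)

  ⟦_⟧ρ ⟦_⟧σ : Formula (S ⊕ ∣v∣) n → Map → Maybe ℕ → Formula S n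
  ⟦ τ ⟧ρ ρ b = instantiate (U ρ b) τ
  ⟦ τ ⟧σ σ b = instantiate (O σ b) τ

  record Query : Set s where
    constructor ⟨_,_,_⟩
    field
      proc    : Proc
      formula : Formula S (∣v∣ proc)
      bound   : ℕ

  -- The queries deleted from 𝒬 by Sum, where σ is the map before the update.
  data SumDeletes (σ : Map) (P : Proc) (ψ : Formula S (∣v∣ P)) (b : ℕ) :
                  Pred Query (s ⊔ lsuc ℓ ⊔ t) where
    deletes : ∀ {η c} → c ≤ b → ⊨ (O σ (just c) P ∧′ ψ ⇒′ ¬′ η) →
              SumDeletes σ P ψ b ⟨ P , η , c ⟩

  sumDeletes? : ∀ σ P ψ b q → Dec (SumDeletes σ P ψ b q)
  sumDeletes? σ P ψ b ⟨ Q , η , c ⟩ with P Fin.≟ Q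
  ... | no P≢Q = no λ { (deletes _ _) → P≢Q refl }
  ... | yes refl with c ℕ.≤? b | valid? (O σ (just c) P ∧′ ψ ⇒′ ¬′ η)
  ...   | yes c≤b | yes v = yes (deletes c≤b v)
  ...   | no c≰b  | _     = no λ { (deletes c≤b _) → c≰b c≤b }
  ...   | _       | no ¬v = no λ { (deletes _ v) → ¬v v }

  data ReachDeletes (P : Proc) (ψ : Formula S (∣v∣ P)) (b : ℕ) :
                    Pred Query (s ⊔ lsuc ℓ ⊔ t) where
    deletes : ∀ {η c} → c ≥ b → ⊭ (ψ ⇒′ ¬′ η) → ReachDeletes P ψ b ⟨ P , η , c ⟩

  reachDeletes? : ∀ P ψ b q → Dec (ReachDeletes P ψ b q)
  reachDeletes? P ψ b ⟨ Q , η , c ⟩ with P Fin.≟ Q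
  ... | no P≢Q = no λ { (deletes _ _) → P≢Q refl }
  ... | yes refl with b ℕ.≤? c | valid? (ψ ⇒′ ¬′ η)
  ...   | yes b≤c | no ¬v = yes (deletes b≤c ¬v)
  ...   | no b≰c  | _     = no λ { (deletes b≤c _) → b≰c b≤c }
  ...   | _       | yes v = no λ { (deletes _ ¬v) → ¬v v }

  -- The formula (∃ (v_P ∪ ℓ_P) ∖ ā. θ)[ā ← v_R], which for arbitrary argument
  -- terms ā is rendered as ∃ v_P ∪ ℓ_P. v_R = ā ∧ θ.  The two are equivalent
  -- whenever ā consists of distinct variables, the case in which the
  -- substitution makes sense.
  callQuery : ∀ {P} R → Vec (Term (functions S) (∣vℓ∣ P)) (∣v∣ R) →
              Formula S (∣vℓ∣ P) → Formula S (∣v∣ R)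
  callQuery {P} R as θ = ∃ⁿ k (⋀ (Vec.toList equations) ∧′ θ [ vars (_↑ˡ ∣v∣ R) ])
    where
    k : ℕ
    k = ∣vℓ∣ P

    equations : Vec (Formula S (k + ∣v∣ R)) (∣v∣ R)
    equations = Vec.zipWith (λ v a → atom (v ≐ a))
                  (vars (k ↑ʳ_)) (as [ vars (_↑ˡ ∣v∣ R) ]ᵗˢ)

  data BndConfig : Set s where
    _∥_∥_   : List Query → Map → Map → BndConfig
    returns : Verdict → Map → Map → BndConfig

  Init : ℕ → Map → Map → BndConfig
  Init n ρ-init σ-init = (⟨ main , ¬′ φ-safe , n ⟩ ∷ []) ∥ ρ-init ∥ σ-init

  data BndSafety (n : ℕ) : BndConfig → BndConfig → Set (s ⊔ lsuc ℓ ⊔ t) where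

    sum : ∀ {𝒬 ρ σ P φ b} (ψ : Formula S (∣v∣ P)) →
      ⟨ P , φ , b ⟩ ∈ 𝒬 →
      ⊨ (⟦ body P ⟧σ σ (b ⊖1) ⇒′ ¬′ (φ ↑)) →
      ⊨ (⟦ body P ⟧σ σ (b ⊖1) ⇒′ ψ ↑) →
      ⊨ (ψ ⇒′ ¬′ φ) →
      BndSafety n (𝒬 ∥ ρ ∥ σ)
                  (filter (¬? ∘ sumDeletes? σ P ψ b) 𝒬 ∥ ρ ∥ add σ P b ψ)

    reach : ∀ {𝒬 ρ σ P φ b} (π : Path P) →
      ⟨ P , φ , b ⟩ ∈ 𝒬 →
      π ∈ᴾ Paths P →
      ⊭ (⟦ conj π ⟧ρ ρ (b ⊖1) ⇒′ ¬′ (φ ↑)) →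
      let ψ = ∃ⁿ (locals P) (⟦ conj π ⟧ρ ρ (b ⊖1)) in
      BndSafety n (𝒬 ∥ ρ ∥ σ)
                  (filter (¬? ∘ reachDeletes? P ψ b) 𝒬 ∥ add ρ P b ψ ∥ σ)

    -- The query has a positive bound b = suc c: for b = 0 every call is
    -- instantiated by ⊥, and the last two ⊨-conditions contradict each other.
    query : ∀ {𝒬 ρ σ P φ c} (πᵤ πᵥ : Path P) R as →
      ⟨ P , φ , suc c ⟩ ∈ 𝒬 →
      ⊨ (⟦ body P ⟧ρ ρ (just c) ⇒′ ¬′ (φ ↑)) →
      (πᵤ ++ pos (call R as) ∷ πᵥ) ∈ᴾ Paths P →
      let u  = ⟦ conj πᵤ ⟧σ σ (just c)
          Rρ = ⟦ atom (call R as) ⟧ρ ρ (just c)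
          Rσ = ⟦ atom (call R as) ⟧σ σ (just c)
          v  = ⟦ conj πᵥ ⟧ρ ρ (just c)
          ψ  = callQuery {P} R as (u ∧′ v ∧′ φ ↑)
      in
      ⊨ (u ∧′ Rρ ∧′ v ⇒′ ¬′ (φ ↑)) →
      ⊭ (u ∧′ Rσ ∧′ v ⇒′ ¬′ (φ ↑)) →
      (∀ η → ⟨ R , η , c ⟩ ∈ 𝒬 → ⊨ (ψ ⇒′ ¬′ η)) →
      BndSafety n (𝒬 ∥ ρ ∥ σ) ((⟨ R , ψ , c ⟩ ∷ 𝒬) ∥ ρ ∥ σ)

    unsafe : ∀ {ρ σ} → ⊭ (U ρ (just n) main ⇒′ φ-safe) →
      BndSafety n ([] ∥ ρ ∥ σ) (returns UNSAFE ρ σ)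

    safe : ∀ {ρ σ} → ⊨ (O σ (just n) main ⇒′ φ-safe) →
      BndSafety n ([] ∥ ρ ∥ σ) (returns SAFE ρ σ)

  Pushable : Map → ℕ → ∀ P → Formula S (∣v∣ P) → Set (s ⊔ lsuc ℓ ⊔ t)
  Pushable σ n P δ = ⊨ (⟦ body P ⟧σ σ (just n) ⇒′ δ ↑)

  -- The update made by CheckInductive.  All tests refer to the initial σ: adding at n + 1 what is
  -- already present at n does not change O σ (just n) up to equivalence.
  push : Map → ℕ → Map
  push σ n P = map (suc n ,_) (filter pushable? ((σ at n) P)) ++ σ P
    where
    pushable? : ∀ δ → Dec (Pushable σ n P δ)
    pushable? δ = valid? (⟦ body P ⟧σ σ (just n) ⇒′ δ ↑)

  Inductive : Map → ℕ → Set (s ⊔ lsuc ℓ ⊔ t)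
  Inductive σ n = ∀ P → All (Pushable σ n P) ((σ at n) P)

  data Config : Set s where
    bounded : ℕ → BndConfig → Config
    return  : Verdict → Config

  start : Config
  start = bounded 0 (Init 0 ∅ ∅)

  infix 4 _⟶_

  data _⟶_ : Config → Config → Set (s ⊔ lsuc ℓ ⊔ t) where
    step          : ∀ {n c c′} → BndSafety n c c′ → bounded n c ⟶ bounded n c′
    unsafe        : ∀ {n ρ σ} → bounded n (returns UNSAFE ρ σ) ⟶ return UNSAFE
    is-inductive  : ∀ {n ρ σ} → Inductive σ n →
                    bounded n (returns SAFE ρ σ) ⟶ return SAFE
    not-inductive : ∀ {n ρ σ} → ¬ Inductive σ n →
                    bounded n (returns SAFE ρ σ) ⟶
                    bounded (suc n) (Init (suc n) ρ (push σ n))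

  -- Whatever the nondeterministic choices, every run is finite and every
  -- maximal run ends by returning r.
  RecMC-returns : Verdict → Set (s ⊔ lsuc ℓ ⊔ t)
  RecMC-returns r =
    Acc (flip _⟶_) start ×
    (∀ {c} → Star _⟶_ start c → IsNormalForm _⟶_ c → c ≡ return r)

{-# OPTIONS --safe #-}
module Submission where

open import Defs
open import Axiom.ExcludedMiddle using (ExcludedMiddle)
open import Level using (Level)
open import Relation.Nullary.Negation using (¬_)

open import Data.Bool.Base using (true; false; T; not; _∧_; _∨_; if_then_else_)
open import Data.Bool.Properties using (T-∧; T-∨; T-≡; T-not-≡; T?)
open import Data.Empty using (⊥; ⊥-elim)
import Data.Empty.Polymorphic as Poly
open import Data.Fin.Base using (Fin; zero; suc; _↑ˡ_; _↑ʳ_)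
import Data.Fin.Properties as Fin
open import Data.List.Base
  using (List; []; _∷_; _++_; map; filter; length; allFin; concatMap; cartesianProduct; cartesianProductWith)
open import Data.List.Membership.Propositional using (_∈_; _∉_)
open import Data.List.Membership.Propositional.Properties
open import Data.List.Properties using (length-++; ++-assoc)
import Data.List.Relation.Binary.Pointwise as Pointwise
open import Data.List.Relation.Binary.Sublist.Heterogeneous.Properties using (length-mono-≤; toPointwise; ++⁺)
open import Data.List.Relation.Binary.Sublist.Propositional using (⊆-refl; ⊆-trans; _∷ʳ_) renaming (_⊆_ to _⊑_)
open import Data.List.Relation.Binary.Sublist.Propositional.Properties using (All-resp-⊆; ++⁺ˡ; ++⁺ʳ)
open import Data.List.Relation.Unary.All as All using (All; []; _∷_)
import Data.List.Relation.Unary.All.Properties as All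
import Data.List.Relation.Unary.Any as Any
open import Data.List.Relation.Unary.Any using (here; there)
open import Data.Maybe.Base using (just)
open import Data.Nat.Base
  using (ℕ; zero; suc; _+_; _*_; _≤_; _<_; _⊔_; z≤n; s≤s; _≤′_; ≤′-refl; ≤′-step)
open import Data.Nat.Induction using (<-wellFounded)
import Data.Nat.ListAction as ListAction
import Data.Nat.Properties as ℕ
open import Data.Product.Base using (Σ; Σ-syntax; ∃-syntax; _×_; _,_; proj₁; proj₂)
open import Data.Product.Function.NonDependent.Propositional using (_×-⇔_)
open import Data.Sum.Base using (_⊎_; inj₁; inj₂)
open import Data.Sum.Function.Propositional using (_⊎-⇔_)
open import Data.Unit.Base using (⊤; tt)
open import Data.Vec.Base as Vec using (Vec; []; _∷_; lookup) renaming (_++_ to _⧺_)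
open import Data.Vec.Properties using (lookup-++ˡ; lookup-++ʳ)
open import Function.Base using (_∘_; id; flip; case_of_)
open import Function.Bundles using (_⇔_; mk⇔; module Equivalence)
open import Function.Properties.Equivalence using () renaming (refl to ⇔-refl; trans to ⇔-trans)
open import Function.Related.TypeIsomorphisms using (→-cong-⇔)
open import Induction.WellFounded using (Acc; acc)
open import Level using (Lift; lift)
open import Relation.Binary.Construct.Closure.ReflexiveTransitive using (Star; ε; _◅_)
open import Relation.Binary.PropositionalEquality
  using (_≡_; _≢_; refl; sym; trans; cong; cong₂; subst; module ≡-Reasoning)
open import Relation.Binary.Rewriting using (IsNormalForm)
open import Relation.Nullary.Decidable using (Dec; yes; no; does; ¬?; decidable-stable)
open import Relation.Nullary.Negation using (contradiction)
open import Relation.Unary using (Pred; Decidable) renaming (_⊆_ to _⊆ᴾ_)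

open Equivalence using (to; from)
open Signature
open Structure using (algebra; Carrier; ⟦rel⟧)
open Theory using (sentences)

-- A counterexample at call depth N survives in every overapproximation at a bound n ≥ N, so no round
-- n ≥ N can return SAFE; an inductive σ would prove the program safe, so no round can at all end the
-- run with SAFE.  What remains is that a round neither blocks nor runs forever.  A query of least
-- bound always admits a step: when neither a summary nor a reachability fact can be derived for it,
-- some call on a path separates the two approximations.  A reach step adds a fact of bound b that
-- was not yet implied by the facts of bound ≤ b, and a prime implicant ranges over finitely many
-- lists of literals, so the numbers of missing facts, listed by increasing bound, decrease
-- lexicographically.  As long as ρ is unchanged, a call from which a query was posed stays settled,
-- because that query or a summary refuting it remains; hence the queries form a finite tree.

private
  variable
    s ℓ t ℓ′ : Level
    m n : ℕ

-- Substitution and evaluation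

module _ {F : Symbols s} (A : Algebra F ℓ) where
  open Algebra A using () renaming (Carrier to ∣A∣)

  lookup-evals : ∀ {k} (ρ : Vec ∣A∣ n) (ts : Vec (Term F n) k) i →
                 lookup (evals A ρ ts) i ≡ eval A ρ (lookup ts i)
  lookup-evals ρ (t ∷ ts) zero    = refl
  lookup-evals ρ (t ∷ ts) (suc i) = lookup-evals ρ ts i

  mutual
    eval-[] : (ρ : Vec ∣A∣ n) (us : Vec (Term F n) m) (t : Term F m) →
              eval A ρ (t [ us ]ᵗ) ≡ eval A (evals A ρ us) t
    eval-[] ρ us (var i)    = sym (lookup-evals ρ us i)
    eval-[] ρ us (fun f ts) = cong (Algebra.⟦fun⟧ A f) (evals-[] ρ us ts)

    evals-[] : ∀ {k} (ρ : Vec ∣A∣ n) (us : Vec (Term F n) m) (ts : Vec (Term F m) k) →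
               evals A ρ (ts [ us ]ᵗˢ) ≡ evals A (evals A ρ us) ts
    evals-[] ρ us []       = refl
    evals-[] ρ us (t ∷ ts) = cong₂ _∷_ (eval-[] ρ us t) (evals-[] ρ us ts)

  evals-vars : (ρ : Vec ∣A∣ n) (f : Fin m → Fin n) (σ : Vec ∣A∣ m) →
               (∀ i → lookup ρ (f i) ≡ lookup σ i) → evals A ρ (vars f) ≡ σ
  evals-vars ρ f []      eq = refl
  evals-vars ρ f (d ∷ σ) eq = cong₂ _∷_ (eq zero) (evals-vars ρ (f ∘ suc) σ (eq ∘ suc))

  evals-underBinder : ∀ (ρ : Vec ∣A∣ n) (us : Vec (Term F n) m) d →
                      evals A (d ∷ ρ) (underBinder us) ≡ d ∷ evals A ρ us
  evals-underBinder ρ us d = cong (d ∷_) (begin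
    evals A (d ∷ ρ) (us [ vars suc ]ᵗˢ)         ≡⟨ evals-[] (d ∷ ρ) (vars suc) us ⟩
    evals A (evals A (d ∷ ρ) (vars suc)) us     ≡⟨ cong (λ σ → evals A σ us) (evals-vars (d ∷ ρ) suc ρ (λ _ → refl)) ⟩
    evals A ρ us                                ∎)
    where open ≡-Reasoning

≡⇒⇔ : {A B : Set ℓ} → A ≡ B → A ⇔ B
≡⇒⇔ refl = ⇔-refl

module _ {S : Signature s} (I : Structure S ℓ) where

  Sat-[] : (φ : Formula S m) (us : Vec (Term (functions S) n) m) (ρ : Vec (Carrier I) n) →
           Sat I (φ [ us ]) ρ ⇔ Sat I φ (evals (algebra I) ρ us)
  Sat-[] (atom (t ≐ u))    us ρ = ≡⇒⇔ (cong₂ _≡_ (eval-[] (algebra I) ρ us t) (eval-[] (algebra I) ρ us u))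
  Sat-[] (atom (rel r ts)) us ρ = ≡⇒⇔ (cong (⟦rel⟧ I r) (evals-[] (algebra I) ρ us ts))
  Sat-[] ⊥′                us ρ = ⇔-refl
  Sat-[] (φ ∧′ ψ)          us ρ = Sat-[] φ us ρ ×-⇔ Sat-[] ψ us ρ
  Sat-[] (φ ∨′ ψ)          us ρ = Sat-[] φ us ρ ⊎-⇔ Sat-[] ψ us ρ
  Sat-[] (φ ⇒′ ψ)          us ρ = →-cong-⇔ (Sat-[] φ us ρ) (Sat-[] ψ us ρ)
  Sat-[] (∀′ φ)            us ρ = mk⇔ (λ h d → to (under d) (h d)) (λ h d → from (under d) (h d))
    where
    under : ∀ d → Sat I (φ [ underBinder us ]) (d ∷ ρ) ⇔ Sat I φ (d ∷ evals (algebra I) ρ us)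
    under d = ⇔-trans (Sat-[] φ (underBinder us) (d ∷ ρ))
                      (≡⇒⇔ (cong (Sat I φ) (evals-underBinder (algebra I) ρ us d)))
  Sat-[] (∃′ φ)            us ρ = mk⇔ (λ (d , h) → d , to (under d) h) (λ (d , h) → d , from (under d) h)
    where
    under : ∀ d → Sat I (φ [ underBinder us ]) (d ∷ ρ) ⇔ Sat I φ (d ∷ evals (algebra I) ρ us)
    under d = ⇔-trans (Sat-[] φ (underBinder us) (d ∷ ρ))
                      (≡⇒⇔ (cong (Sat I φ) (evals-underBinder (algebra I) ρ us d)))

  Sat-vars : (φ : Formula S m) (f : Fin m → Fin n) (ρ : Vec (Carrier I) n) (σ : Vec (Carrier I) m) →
             (∀ i → lookup ρ (f i) ≡ lookup σ i) → Sat I (φ [ vars f ]) ρ ⇔ Sat I φ σ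
  Sat-vars φ f ρ σ eq = ⇔-trans (Sat-[] φ (vars f) ρ)
                                (≡⇒⇔ (cong (Sat I φ) (evals-vars (algebra I) ρ f σ eq)))

  Sat-∃ⁿ : ∀ k (φ : Formula S (k + n)) ρ → Sat I (∃ⁿ k φ) ρ ⇔ (∃[ ds ] Sat I φ (ds ⧺ ρ))
  Sat-∃ⁿ zero    φ ρ = mk⇔ ([] ,_) λ { ([] , h) → h }
  Sat-∃ⁿ (suc k) φ ρ = mk⇔
    (λ h → let ds , d , h′ = to (Sat-∃ⁿ k (∃′ φ) ρ) h in d ∷ ds , h′)
    λ { (d ∷ ds , h) → from (Sat-∃ⁿ k (∃′ φ) ρ) (ds , d , h) }

  Sat-⋀ : (φs : List (Formula S n)) (ρ : Vec (Carrier I) n) →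
          Sat I (⋀ φs) ρ ⇔ All (λ φ → Sat I φ ρ) φs
  Sat-⋀ []       ρ = mk⇔ (λ _ → []) (λ _ h → h)
  Sat-⋀ (φ ∷ φs) ρ = mk⇔ (λ (h , hs) → h ∷ to (Sat-⋀ φs ρ) hs)
                         λ { (h ∷ hs) → h , from (Sat-⋀ φs ρ) hs }

  Sat-⋁ : (φs : List (Formula S n)) (ρ : Vec (Carrier I) n) →
          Sat I (⋁ φs) ρ ⇔ (∃[ φ ] φ ∈ φs × Sat I φ ρ)
  Sat-⋁ []       ρ = mk⇔ (λ { (lift ()) }) λ { (_ , () , _) }
  Sat-⋁ (φ ∷ φs) ρ = mk⇔
    (λ { (inj₁ h) → φ , here refl , h
       ; (inj₂ h) → let ψ , ψ∈ , h′ = to (Sat-⋁ φs ρ) h in ψ , there ψ∈ , h′ })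
    λ { (_ , here refl , h) → inj₁ h
      ; (ψ , there ψ∈ , h)  → inj₂ (from (Sat-⋁ φs ρ) (ψ , ψ∈ , h)) }

  Sat-conj : (π : List (Literal S n)) (ρ : Vec (Carrier I) n) →
             Sat I (conj π) ρ ⇔ All (λ l → Sat I (literal l) ρ) π
  Sat-conj π ρ = ⇔-trans (Sat-⋀ (map literal π) ρ) (mk⇔ All.map⁻ All.map⁺)

  Sat-equations : ∀ {j} (f : Fin j → Fin n) (ts : Vec (Term (functions S) n) j)
                  (ρ : Vec (Carrier I) n) (σ : Vec (Carrier I) j) →
                  (∀ i → lookup ρ (f i) ≡ lookup σ i) →
                  Sat I (⋀ (Vec.toList (Vec.zipWith (λ v a → atom (v ≐ a)) (vars f) ts))) ρ
                    ⇔ σ ≡ evals (algebra I) ρ ts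
  Sat-equations f []       ρ []      eq = mk⇔ (λ _ → refl) (λ _ h → h)
  Sat-equations f (t ∷ ts) ρ (d ∷ σ) eq = mk⇔
    (λ (h , hs) → cong₂ _∷_ (trans (sym (eq zero)) h) (to IH hs))
    (λ e → trans (eq zero) (cong Vec.head e) , from IH (cong Vec.tail e))
    where
    IH = Sat-equations (f ∘ suc) ts ρ σ (eq ∘ suc)

-- Prime implicants

atomOf : {S : Signature s} → Literal S n → Atom S n
atomOf (pos a) = a
atomOf (neg a) = a

atoms : {S : Signature s} (φ : Formula S n) → QuantifierFree φ → List (Atom S n)
atoms (atom a) _         = a ∷ []
atoms ⊥′       _         = []
atoms (φ ∧′ ψ) (qφ , qψ) = atoms φ qφ ++ atoms ψ qψ
atoms (φ ∨′ ψ) (qφ , qψ) = atoms φ qφ ++ atoms ψ qψ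
atoms (φ ⇒′ ψ) (qφ , qψ) = atoms φ qφ ++ atoms ψ qψ

-- Puts all prime implicants, and their prefixes and suffixes, into one finite list without deciding
-- primality.
words : ∀ {A : Set ℓ} → ℕ → List A → List (List A)
words zero    xs = [] ∷ []
words (suc k) xs = [] ∷ cartesianProductWith _∷_ xs (words k xs)

∈-words : ∀ {A : Set ℓ} k {w xs : List A} → All (_∈ xs) w → length w ≤ k → w ∈ words k xs
∈-words zero    []       le       = here refl
∈-words (suc k) []       le       = here refl
∈-words (suc k) (x∈ ∷ w⊆) (s≤s le) =
  there (∈-cartesianProductWith⁺ _∷_ x∈ (∈-words k w⊆ le))

-- Pigeonhole: deleting from `xs` the occurrence of the head leaves a list that still contains the
-- tail, because the head does not recur. Non-repetition is phrased through decompositions, the form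
-- in which minimality of an implicant yields it.
nonrepeating-length-≤ : ∀ {A : Set ℓ} (w xs : List A) →
  (∀ u {x v} → w ≡ u ++ x ∷ v → x ∉ u ++ v) → All (_∈ xs) w → length w ≤ length xs
nonrepeating-length-≤ []      xs nr []        = z≤n
nonrepeating-length-≤ (x ∷ w) xs nr (x∈ ∷ w⊆) with ∈-∃++ x∈
... | ys , zs , refl = begin
  suc (length w)                ≤⟨ s≤s (nonrepeating-length-≤ w (ys ++ zs) nr′ (All.tabulate remains)) ⟩
  suc (length (ys ++ zs))       ≡⟨ cong suc (length-++ ys) ⟩
  suc (length ys + length zs)   ≡⟨ ℕ.+-suc (length ys) (length zs) ⟨
  length ys + suc (length zs)   ≡⟨ length-++ ys ⟨
  length (ys ++ x ∷ zs)         ∎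
  where
  open ℕ.≤-Reasoning
  nr′ : ∀ u {y v} → w ≡ u ++ y ∷ v → y ∉ u ++ v
  nr′ u refl y∈ = nr (x ∷ u) refl (there y∈)
  remains : ∀ {y} → y ∈ w → y ∈ ys ++ zs
  remains y∈w with ∈-++⁻ ys (All.lookup w⊆ y∈w)
  ... | inj₁ y∈ys         = ∈-++⁺ˡ y∈ys
  ... | inj₂ (here refl)  = contradiction y∈w (nr [] refl)
  ... | inj₂ (there y∈zs) = ∈-++⁺ʳ ys y∈zs

module Classical (em : ∀ {a : Level} → ExcludedMiddle a) where

  by-contradiction : {A : Set ℓ} → ¬ ¬ A → A
  by-contradiction = decidable-stable em

  module _ {S : Signature s} {n : ℕ} where

    Makes-cong : ∀ {v w : Valuation {S = S} n} l → v (atomOf l) ≡ w (atomOf l) →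
                 Makes v True l → Makes w True l
    Makes-cong (pos a) eq = subst T eq
    Makes-cong (neg a) eq = subst (T ∘ not) eq

    Makes-determines : ∀ {v w : Valuation {S = S} n} l →
                       Makes v True l → Makes w True l → v (atomOf l) ≡ w (atomOf l)
    Makes-determines {v} {w} (pos a) hv hw with v a | w a
    ... | true  | true  = refl
    Makes-determines {v} {w} (neg a) hv hw with v a | w a
    ... | false | false = refl

    truth-cong : ∀ {v w : Valuation {S = S} n} φ qf → (∀ {a} → a ∈ atoms φ qf → v a ≡ w a) →
                 truth v φ qf ≡ truth w φ qf
    truth-cong (atom a) _         eq = eq (here refl)
    truth-cong ⊥′       _         eq = refl
    truth-cong (φ ∧′ ψ) (qφ , qψ) eq =
      cong₂ _∧_ (truth-cong φ qφ (eq ∘ ∈-++⁺ˡ)) (truth-cong ψ qψ (eq ∘ ∈-++⁺ʳ _))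
    truth-cong (φ ∨′ ψ) (qφ , qψ) eq =
      cong₂ _∨_ (truth-cong φ qφ (eq ∘ ∈-++⁺ˡ)) (truth-cong ψ qψ (eq ∘ ∈-++⁺ʳ _))
    truth-cong (φ ⇒′ ψ) (qφ , qψ) eq =
      cong₂ (λ b c → not b ∨ c) (truth-cong φ qφ (eq ∘ ∈-++⁺ˡ)) (truth-cong ψ qψ (eq ∘ ∈-++⁺ʳ _))

    -- Atoms over an arbitrary signature come without decidable equality, hence `em`.
    override : Atom S n → Valuation {S = S} n → Valuation {S = S} n → Valuation {S = S} n
    override a w v b = if does (em {P = b ≡ a}) then w b else v b

    override-≡ : ∀ a w v → override a w v a ≡ w a
    override-≡ a w v with em {P = a ≡ a}
    ... | yes _  = refl
    ... | no a≢a = contradiction refl a≢a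

    override-cases : ∀ a w v b → (b ≡ a × override a w v b ≡ w b) ⊎ (b ≢ a × override a w v b ≡ v b)
    override-cases a w v b with em {P = b ≡ a}
    ... | yes b≡a = inj₁ (b≡a , refl)
    ... | no b≢a  = inj₂ (b≢a , refl)

    module _ {φ : Formula S n} {qf : QuantifierFree φ} where

      -- Minimality: if no such valuations existed, dropping `l` would leave an implicant. So the
      -- truth of `φ` really depends on the atom of `l`. Three facts are read off from this: the
      -- atom occurs in `φ`, the literal is not repeated, and a call is never negated.
      essential : ∀ u {l r} → PrimeImplicant φ qf (u ++ l ∷ r) →
        ∃[ w ] ∃[ v ] Makes w True l × All (Makes v True) (u ++ r) ×
                      T (truth (override (atomOf l) w v) φ qf) × ¬ T (truth v φ qf)
      essential u {l} {r} (((w , hw) , implies) , minimal) = by-contradiction λ none →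
        let dropped : Implicant φ qf (u ++ r)
            dropped = (w , hw′) , λ v hv → decidable-stable (T? _) λ ¬φ →
              none (w , v , hl , hv , implies _ (All.++⁺ (overridden v (All.++⁻ˡ u hw′) (All.++⁻ˡ u hv))
                (Makes-cong l (sym (override-≡ (atomOf l) w v)) hl ∷
                 overridden v (All.++⁻ʳ u hw′) (All.++⁻ʳ u hv))) , ¬φ)
        in ℕ.<-irrefl (cong length (minimal (u ++ r) (++⁺ ⊆-refl (l ∷ʳ ⊆-refl)) dropped))
             (shorter (ℕ.+-monoʳ-< (length u) (ℕ.n<1+n (length r))))
        where
        hl : Makes w True l
        hl = All.head (All.++⁻ʳ u hw)
        hw′ : All (Makes w True) (u ++ r)
        hw′ = All.++⁺ (All.++⁻ˡ u hw) (All.tail (All.++⁻ʳ u hw))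
        -- Another literal may share the overridden atom; it then takes its value from `w`, which
        -- satisfies the whole implicant.
        overridden : ∀ v {π} → All (Makes w True) π → All (Makes v True) π →
                     All (Makes (override (atomOf l) w v) True) π
        overridden v []        []        = []
        overridden v {l′ ∷ _} (h ∷ hs) (k ∷ ks) with override-cases (atomOf l) w v (atomOf l′)
        ... | inj₁ (_ , eq) = Makes-cong l′ (sym eq) h ∷ overridden v hs ks
        ... | inj₂ (_ , eq) = Makes-cong l′ (sym eq) k ∷ overridden v hs ks
        shorter : length u + length r < length u + suc (length r) → length (u ++ r) < length (u ++ l ∷ r)
        shorter h rewrite length-++ u {r} | length-++ u {l ∷ r} = h

      -- Overriding an atom that does not occur in `φ` could not change its truth value.
      prime-atoms : ∀ {π} → PrimeImplicant φ qf π → ∀ {l} → l ∈ π → atomOf l ∈ atoms φ qf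
      prime-atoms prime {l} l∈π with ∈-∃++ l∈π
      ... | u , r , refl with essential u prime
      ...   | w , v , _ , _ , t , ¬t = by-contradiction λ ∉atoms →
        ¬t (subst T (truth-cong φ qf λ {a} a∈ → case override-cases (atomOf l) w v a of λ
          { (inj₁ (refl , _)) → contradiction a∈ ∉atoms
          ; (inj₂ (_ , eq))   → eq }) t)

      -- A second copy of `l` already fixes `v` at that atom to the value given by `w`, so
      -- overriding would change nothing.
      prime-nonrepeating : ∀ u {l r} → PrimeImplicant φ qf (u ++ l ∷ r) → l ∉ u ++ r
      prime-nonrepeating u {l} prime l∈ with essential u prime
      ... | w , v , hl , hs , t , ¬t =
        ¬t (subst T (truth-cong φ qf λ {a} _ → case override-cases (atomOf l) w v a of λ
          { (inj₁ (refl , eq)) → trans eq (Makes-determines l hl (All.lookup hs l∈))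
          ; (inj₂ (_ , eq))    → eq }) t)

      literals : List (Literal S n)
      literals = map pos (atoms φ qf) ++ map neg (atoms φ qf)

      prime-literals : ∀ {π} → PrimeImplicant φ qf π → All (_∈ literals) π
      prime-literals prime = All.tabulate λ
        { {pos a} l∈ → ∈-++⁺ˡ (∈-map⁺ pos (prime-atoms prime l∈))
        ; {neg a} l∈ → ∈-++⁺ʳ _ (∈-map⁺ neg (prime-atoms prime l∈)) }

      prime-length-≤ : ∀ {π} → PrimeImplicant φ qf π → length π ≤ length literals
      prime-length-≤ prime = nonrepeating-length-≤ _ literals
        (λ { u refl → prime-nonrepeating u prime }) (prime-literals prime)

      prime-exists : ∀ π → Implicant φ qf π → ∃[ π′ ] π′ ⊑ π × PrimeImplicant φ qf π′
      prime-exists π = go π (<-wellFounded (length π))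
        where
        go : ∀ π → Acc _<_ (length π) → Implicant φ qf π → ∃[ π′ ] π′ ⊑ π × PrimeImplicant φ qf π′
        go π (acc rec) imp with em {P = ∃[ π′ ] π′ ⊑ π × Implicant φ qf π′ × π′ ≢ π}
        ... | no none = π , ⊆-refl , imp , λ π′ sub imp′ →
                by-contradiction λ ≢π → none (π′ , sub , imp′ , ≢π)
        ... | yes (π′ , sub , imp′ , ≢π) =
                let π″ , sub′ , prime = go π′ (rec (ℕ.≤∧≢⇒< (length-mono-≤ sub)
                      λ eq → ≢π (Pointwise.Pointwise-≡⇒≡ (toPointwise eq sub)))) imp′
                in π″ , ⊆-trans sub′ sub , prime

    module _ (K : Structure S ℓ) (ρ : Vec (Carrier K) n) where

      valuation : Valuation {S = S} n
      valuation a = does (em {P = Sat K (atom a) ρ})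

      T-valuation : ∀ a → T (valuation a) ⇔ Sat K (atom a) ρ
      T-valuation a with em {P = Sat K (atom a) ρ}
      ... | yes h = mk⇔ (λ _ → h) _
      ... | no ¬h = mk⇔ (λ ()) ¬h

      T-truth : ∀ φ qf → T (truth valuation φ qf) ⇔ Sat K φ ρ
      T-truth (atom a) _         = T-valuation a
      T-truth ⊥′       _         = mk⇔ (λ ()) λ ()
      T-truth (φ ∧′ ψ) (qφ , qψ) = ⇔-trans T-∧ (T-truth φ qφ ×-⇔ T-truth ψ qψ)
      T-truth (φ ∨′ ψ) (qφ , qψ) = ⇔-trans T-∨ (T-truth φ qφ ⊎-⇔ T-truth ψ qψ)
      T-truth (φ ⇒′ ψ) (qφ , qψ) with truth valuation φ qφ | T-truth φ qφ
      ... | true  | IH = ⇔-trans (T-truth ψ qψ) (mk⇔ (λ h _ → h) (λ h → h (to IH tt)))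
      ... | false | IH = mk⇔ (λ _ h → contradiction (from IH h) id) _

      Makes-valuation : ∀ l → Makes valuation True l ⇔ Sat K (literal l) ρ
      Makes-valuation (pos a) = T-valuation a
      Makes-valuation (neg a) with valuation a | T-valuation a
      ... | true  | IH = mk⇔ (λ ()) (λ h → contradiction (h (to IH tt)) λ ())
      ... | false | IH = mk⇔ (λ _ h → contradiction (from IH h) id) _

      implicant-sound : ∀ {φ qf π} → Implicant φ qf π → Sat K (conj π) ρ → Sat K φ ρ
      implicant-sound {φ} {qf} {π} (_ , implies) h =
        to (T-truth φ qf) (implies valuation (All.map (λ {l} → from (Makes-valuation l)) (to (Sat-conj K π ρ) h)))

      -- The diagram lists the atoms of `φ` with their actual signs. It is an implicant, because
      -- truth of `φ` depends on these atoms only, and every sublist of it holds at `ρ`; a prime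
      -- implicant is found among the sublists.
      prime-complete : ∀ φ qf → Sat K φ ρ → ∃[ π ] PrimeImplicant φ qf π × Sat K (conj π) ρ
      prime-complete φ qf h =
        let π , sub , prime = prime-exists {φ} {qf} diagram ((valuation , makes (atoms φ qf)) , λ v hv →
              subst T (truth-cong {v = valuation} {v} φ qf (agree v (atoms φ qf) hv)) (from (T-truth φ qf) h))
        in π , prime ,
           from (Sat-conj K π ρ) (All.map (λ {l} → to (Makes-valuation l)) (All-resp-⊆ sub (makes (atoms φ qf))))
        where
        decide : Atom S n → Literal S n
        decide a = if valuation a then pos a else neg a
        diagram : List (Literal S n)
        diagram = map decide (atoms φ qf)
        makes : ∀ as → All (Makes valuation True) (map decide as)
        makes []       = []
        makes (a ∷ as) = head ∷ makes as
          where
          head : Makes valuation True (decide a)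
          head with valuation a in eq
          ... | true  = subst T (sym eq) tt
          ... | false = subst (T ∘ not) (sym eq) tt
        decides : ∀ v a → Makes v True (decide a) → valuation a ≡ v a
        decides v a hv with valuation a
        ... | true  = sym (to T-≡ hv)
        ... | false = sym (to T-not-≡ hv)
        agree : ∀ v as → All (Makes v True) (map decide as) → ∀ {a} → a ∈ as → valuation a ≡ v a
        agree v (a ∷ as) (hv ∷ hvs) (here refl) = decides v a hv
        agree v (a ∷ as) (hv ∷ hvs) (there a∈)  = agree v as hvs a∈

-- Programs

-- The common shape of the lists behind `U`, `O` and `_at_`.
selection : {A : Set ℓ} {B : Pred ℕ t} → Decidable B → List (ℕ × A) → List A
selection B? xs = map proj₂ (filter (B? ∘ proj₁) xs)

∈-selection : {A : Set ℓ} {B : Pred ℕ t} (B? : Decidable B) (xs : List (ℕ × A)) →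
              ∀ {x} → x ∈ selection B? xs ⇔ (∃[ c ] (c , x) ∈ xs × B c)
∈-selection B? xs = mk⇔
  (λ x∈ → case ∈-map⁻ proj₂ x∈ of λ { ((c , x) , cx∈ , refl) → c , ∈-filter⁻ (B? ∘ proj₁) {xs = xs} cx∈ })
  (λ (c , cx∈ , Bc) → ∈-map⁺ proj₂ (∈-filter⁺ (B? ∘ proj₁) cx∈ Bc))

module _ {S : Signature s} {k : ℕ} {ar : Fin k → ℕ} where

  CallsPositive-conj : (π : List (Literal (S ⊕ ar) n)) →
                       CallsPositive (conj π) ⇔ All (CallsPositive ∘ literal) π
  CallsPositive-conj []      = mk⇔ (λ _ → []) _
  CallsPositive-conj (l ∷ π) = mk⇔ (λ (h , hs) → h ∷ to (CallsPositive-conj π) hs)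
                                   λ { (h ∷ hs) → h , from (CallsPositive-conj π) hs }

  CallsNegative? : (a : Atom (S ⊕ ar) n) → Dec (CallsNegative (atom a))
  CallsNegative? (_ ≐ _)          = yes tt
  CallsNegative? (rel (inj₁ _) _) = yes tt
  CallsNegative? (rel (inj₂ _) _) = no λ ()

  module _ {v w : Valuation {S = S ⊕ ar} n}
           (same : ∀ a → CallsNegative (atom a) → v a ≡ w a)
           (less : ∀ a → T (v a) → T (w a)) where

    mutual
      -- The propositional counterpart of `monotone`: `v` and `w` differ only at calls, where `w` is
      -- the larger, and calls occur positively.
      truth-monotone : ∀ φ qf → CallsPositive φ → T (truth v φ qf) → T (truth w φ qf)
      truth-monotone (atom a) _         _         h = less a h
      truth-monotone (φ ∧′ ψ) (qφ , qψ) (cφ , cψ) h =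
        let hφ , hψ = to T-∧ h in from T-∧ (truth-monotone φ qφ cφ hφ , truth-monotone ψ qψ cψ hψ)
      truth-monotone (φ ∨′ ψ) (qφ , qψ) (cφ , cψ) h with to T-∨ h
      ... | inj₁ hφ = from T-∨ (inj₁ (truth-monotone φ qφ cφ hφ))
      ... | inj₂ hψ = from (T-∨ {truth w φ qφ}) (inj₂ (truth-monotone ψ qψ cψ hψ))
      truth-monotone (φ ⇒′ ψ) (qφ , qψ) (cφ , cψ) h with truth w φ qφ in eq
      ... | false = tt
      ... | true with truth v φ qφ | truth-antitone φ qφ cφ (subst T (sym eq) tt)
      ...   | true | _ = truth-monotone ψ qψ cψ h

      truth-antitone : ∀ φ qf → CallsNegative φ → T (truth w φ qf) → T (truth v φ qf)
      truth-antitone (atom a) _         c         h = subst T (sym (same a c)) h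
      truth-antitone (φ ∧′ ψ) (qφ , qψ) (cφ , cψ) h =
        let hφ , hψ = to T-∧ h in from T-∧ (truth-antitone φ qφ cφ hφ , truth-antitone ψ qψ cψ hψ)
      truth-antitone (φ ∨′ ψ) (qφ , qψ) (cφ , cψ) h with to T-∨ h
      ... | inj₁ hφ = from T-∨ (inj₁ (truth-antitone φ qφ cφ hφ))
      ... | inj₂ hψ = from (T-∨ {truth v φ qφ}) (inj₂ (truth-antitone ψ qψ cψ hψ))
      truth-antitone (φ ⇒′ ψ) (qφ , qψ) (cφ , cψ) h with truth v φ qφ in eq
      ... | false = tt
      ... | true with truth w φ qφ | truth-monotone φ qφ cφ (subst T (sym eq) tt)
      ...   | true | _ = truth-antitone ψ qψ cψ h

module _ {S : Signature s} (𝒜 : Program S) (I : Structure S ℓ) where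
  open Program 𝒜
  open Semantics 𝒜
  open Maps 𝒜

  -- Carries monotonicity and implicants, which concern the extended signature, over to the
  -- instantiated formulas on which the tests are run.
  Sat-instantiate : (Φ : ∀ Q → Formula S (∣v∣ Q)) (τ : Formula (S ⊕ ∣v∣) n) (ρ : Vec (Carrier I) n) →
                    Sat I (instantiate Φ τ) ρ ⇔ Sat (J I λ Q → Sat I (Φ Q)) τ ρ
  Sat-instantiate Φ (atom (t ≐ u))           ρ = ⇔-refl
  Sat-instantiate Φ (atom (rel (inj₁ r) ts)) ρ = ⇔-refl
  Sat-instantiate Φ (atom (rel (inj₂ Q) ts)) ρ = Sat-[] I (Φ Q) ts ρ
  Sat-instantiate Φ ⊥′                       ρ = ⇔-refl
  Sat-instantiate Φ (φ ∧′ ψ)                 ρ = Sat-instantiate Φ φ ρ ×-⇔ Sat-instantiate Φ ψ ρ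
  Sat-instantiate Φ (φ ∨′ ψ)                 ρ = Sat-instantiate Φ φ ρ ⊎-⇔ Sat-instantiate Φ ψ ρ
  Sat-instantiate Φ (φ ⇒′ ψ)                 ρ = →-cong-⇔ (Sat-instantiate Φ φ ρ) (Sat-instantiate Φ ψ ρ)
  Sat-instantiate Φ (∀′ φ)                   ρ =
    mk⇔ (λ h d → to (Sat-instantiate Φ φ (d ∷ ρ)) (h d)) (λ h d → from (Sat-instantiate Φ φ (d ∷ ρ)) (h d))
  Sat-instantiate Φ (∃′ φ)                   ρ =
    mk⇔ (λ (d , h) → d , to (Sat-instantiate Φ φ (d ∷ ρ)) h) (λ (d , h) → d , from (Sat-instantiate Φ φ (d ∷ ρ)) h)

  instantiate-monotone : {Φ Ψ : ∀ Q → Formula S (∣v∣ Q)} → (∀ Q → Sat I (Φ Q) ⊆ᴾ Sat I (Ψ Q)) →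
    ∀ (τ : Formula (S ⊕ ∣v∣) n) → CallsPositive τ → Sat I (instantiate Φ τ) ⊆ᴾ Sat I (instantiate Ψ τ)
  instantiate-monotone {Φ = Φ} {Ψ} Φ⊆Ψ τ c h =
    from (Sat-instantiate Ψ τ _) (monotone I (λ Q → Φ⊆Ψ Q) τ c (to (Sat-instantiate Φ τ _) h))

  Sat-↑ : ∀ P (φ : Formula S (∣v∣ P)) (ls : Vec (Carrier I) (locals P)) a →
          Sat I (_↑ {P} φ) (ls ⧺ a) ⇔ Sat I φ a
  Sat-↑ P φ ls a = Sat-vars I φ (locals P ↑ʳ_) (ls ⧺ a) a (lookup-++ʳ ls a)

  Sat-U : ∀ m b P a → Sat I (U m (just b) P) a ⇔ (∃[ c ] ∃[ δ ] (c , δ) ∈ m P × c ≤ b × Sat I δ a)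
  Sat-U m b P a = ⇔-trans (Sat-⋁ I (selection (ℕ._≤? b) (m P)) a) (mk⇔
    (λ (δ , δ∈ , h) → let c , cδ∈ , c≤b = to (∈-selection (ℕ._≤? b) (m P)) δ∈ in c , δ , cδ∈ , c≤b , h)
    (λ (c , δ , cδ∈ , c≤b , h) → δ , from (∈-selection (ℕ._≤? b) (m P)) (c , cδ∈ , c≤b) , h))

  Sat-O : ∀ m b P a → Sat I (O m (just b) P) a ⇔ (∀ c δ → (c , δ) ∈ m P → b ≤ c → Sat I δ a)
  Sat-O m b P a = ⇔-trans (Sat-⋀ I (selection (b ℕ.≤?_) (m P)) a) (mk⇔
    (λ hs c δ cδ∈ b≤c → All.lookup hs (from (∈-selection (b ℕ.≤?_) (m P)) (c , cδ∈ , b≤c)))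
    (λ h → All.tabulate λ {δ} δ∈ → let c , cδ∈ , b≤c = to (∈-selection (b ℕ.≤?_) (m P)) δ∈ in h c δ cδ∈ b≤c))

  -- Index k stands for the bound k − 1.
  iterate : ℕ → Interpretation I
  iterate zero    P a = Poly.⊥
  iterate (suc k) P a =
    Σ[ ls ∈ Vec (Carrier I) (locals P) ] Sat (J I (iterate k)) (body P) (ls ⧺ a)

  iterate-monotone : ∀ {j k} → j ≤ k → ∀ P → iterate j P ⊆ᴾ iterate k P
  iterate-monotone (s≤s j≤k) P (ls , h) =
    ls , monotone I (λ Q → iterate-monotone j≤k Q) (body P) (callsPositive P) h

  Closed-intro : {X : Interpretation I} →
    (∀ Q ls a → Sat (J I X) (body Q) (ls ⧺ a) → X Q a) → Closed I X
  Closed-intro {X} h Q ρ sat with Vec.splitAt (locals Q) ρ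
  ... | ls , a , refl = subst (X Q)
    (sym (evals-vars (algebra I) (ls ⧺ a) (locals Q ↑ʳ_) a (lookup-++ʳ ls a))) (h Q ls a sat)

-- Call depth and the least interpretation

module Bounds (em : ∀ {a : Level} → ExcludedMiddle a) {S : Signature s} (𝒜 : Program S) where
  open Classical em
  open Program 𝒜
  open Semantics 𝒜
  open Maps 𝒜

  module _ (I : Structure S ℓ) where

    eventually : Interpretation I
    eventually P a = ∃[ k ] iterate 𝒜 I k P a

    -- At a fixed assignment a quantifier-free formula consults finitely many call tuples. The
    -- iterates increase, so each tuple enters at a finite stage or never; the maximum of these
    -- stages serves for the whole formula.
    stabilises : (φ : Formula (S ⊕ ∣v∣) n) → QuantifierFree φ → (ρ : Vec (Carrier I) n) →
      ∃[ N ] (∀ {k} → N ≤ k → Sat (J I (iterate 𝒜 I k)) φ ρ ⇔ Sat (J I eventually) φ ρ)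
    stabilises (atom (t ≐ u))           _ ρ = 0 , λ _ → ⇔-refl
    stabilises (atom (rel (inj₁ r) ts)) _ ρ = 0 , λ _ → ⇔-refl
    stabilises (atom (rel (inj₂ Q) ts)) _ ρ with em {P = eventually Q (evals (algebra I) ρ ts)}
    ... | yes (N , h) = N , λ N≤k → mk⇔ (λ _ → N , h) (λ _ → iterate-monotone 𝒜 I N≤k Q h)
    ... | no ¬h       = 0 , λ _ → mk⇔ (λ h → _ , h) (λ h → contradiction h ¬h)
    stabilises ⊥′ _ ρ = 0 , λ _ → ⇔-refl
    stabilises (φ ∧′ ψ) (qφ , qψ) ρ =
      let M , hφ = stabilises φ qφ ρ ; N , hψ = stabilises ψ qψ ρ
      in M ⊔ N , λ le → hφ (ℕ.m⊔n≤o⇒m≤o M N le) ×-⇔ hψ (ℕ.m⊔n≤o⇒n≤o M N le)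
    stabilises (φ ∨′ ψ) (qφ , qψ) ρ =
      let M , hφ = stabilises φ qφ ρ ; N , hψ = stabilises ψ qψ ρ
      in M ⊔ N , λ le → hφ (ℕ.m⊔n≤o⇒m≤o M N le) ⊎-⇔ hψ (ℕ.m⊔n≤o⇒n≤o M N le)
    stabilises (φ ⇒′ ψ) (qφ , qψ) ρ =
      let M , hφ = stabilises φ qφ ρ ; N , hψ = stabilises ψ qψ ρ
      in M ⊔ N , λ le → →-cong-⇔ (hφ (ℕ.m⊔n≤o⇒m≤o M N le)) (hψ (ℕ.m⊔n≤o⇒n≤o M N le))

    eventually-closed : Closed I eventually
    eventually-closed = Closed-intro 𝒜 I λ Q ls a h →
      let N , stable = stabilises (body Q) (quantifierFree Q) (ls ⧺ a)
      in suc N , ls , from (stable ℕ.≤-refl) h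

  -- The union of the finite iterates is closed, so it contains the least interpretation, and a
  -- violating tuple already lies in some finite iterate.
  bounded-counterexample : (Th : Theory S ℓ t) (P : Proc) (φ : Formula S (∣v∣ P)) → ¬ Safe Th P φ →
    ∃[ N ] Σ[ I ∈ Structure S ℓ ] IsModel (sentences Th) I × ∃[ a ] iterate 𝒜 I N P a × ¬ Sat I φ a
  bounded-counterexample Th P φ unsafe = by-contradiction λ none →
    unsafe λ I mod X (_ , least) {a} Xa →
      let N , h = least (eventually I) (eventually-closed I) P Xa
      in by-contradiction λ ¬φ → none (N , I , mod , a , h , ¬φ)

  -- If a call were negated, then by `essential` making it false would turn a falsified body into a
  -- true one. Calls occur only positively in the body, so raising the call back could not falsify
  -- it.
  prime-callsPositive : ∀ P {π} → Paths P π → CallsPositive (conj π)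
  prime-callsPositive P {π} prime = from (CallsPositive-conj π) (All.tabulate positive)
    where
    positive : ∀ {l} → l ∈ π → CallsPositive (literal l)
    positive {pos a} _ = tt
    positive {neg a} l∈ with CallsNegative? a | ∈-∃++ l∈
    ... | yes c  | _ = c , tt
    ... | no ¬c  | u , r , refl with essential {φ = body P} {quantifierFree P} u prime
    ...   | w , v , ¬wa , _ , t , ¬t = contradiction
      (truth-monotone {v = override a w v} {v} same less (body P) (quantifierFree P) (callsPositive P) t) ¬t
      where
      same : ∀ b → CallsNegative (atom b) → override a w v b ≡ v b
      same b c with override-cases a w v b
      ... | inj₁ (refl , _) = contradiction c ¬c
      ... | inj₂ (_ , eq)   = eq
      less : ∀ b → T (override a w v b) → T (v b)
      less b h with override-cases a w v b
      ... | inj₁ (refl , eq) = ⊥-elim (subst T (trans eq (to T-not-≡ ¬wa)) h)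
      ... | inj₂ (_ , eq)    = subst T eq h

  module _ (m : Map) (P : Proc) (b : ℕ) (ψ : Formula S (∣v∣ P)) where

    ∈-add-new : (b , ψ) ∈ add m P b ψ P
    ∈-add-new with P Fin.≟ P
    ... | yes refl = here refl
    ... | no P≢P   = contradiction refl P≢P

    ∈-add-old : ∀ {Q x} → x ∈ m Q → x ∈ add m P b ψ Q
    ∈-add-old {Q} x∈ with P Fin.≟ Q
    ... | yes refl = there x∈
    ... | no _     = x∈

    ∈-add⁻ : ∀ {Q c δ} → (c , δ) ∈ add m P b ψ Q →
             (c , δ) ∈ m Q ⊎ _≡_ {A = Σ[ R ∈ Proc ] ℕ × Formula S (∣v∣ R)} (Q , c , δ) (P , b , ψ)
    ∈-add⁻ {Q} x∈ with P Fin.≟ Q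
    ∈-add⁻ (here refl) | yes refl = inj₂ refl
    ∈-add⁻ (there x∈)  | yes refl = inj₁ x∈
    ∈-add⁻ x∈          | no _     = inj₁ x∈

  module _ (I : Structure S ℓ) (m : Map) (P : Proc) (b : ℕ) (ψ : Formula S (∣v∣ P)) where

    U-add-⊇ : ∀ c Q → Sat I (U m c Q) ⊆ᴾ Sat I (U (add m P b ψ) c Q)
    U-add-⊇ (just c) Q h =
      let d , δ , δ∈ , le , hδ = to (Sat-U 𝒜 I m c Q _) h
      in from (Sat-U 𝒜 I (add m P b ψ) c Q _) (d , δ , ∈-add-old m P b ψ δ∈ , le , hδ)

    U-add-⊆ : ∀ {c} → c < b → ∀ Q → Sat I (U (add m P b ψ) (just c) Q) ⊆ᴾ Sat I (U m (just c) Q)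
    U-add-⊆ {c} c<b Q h with to (Sat-U 𝒜 I (add m P b ψ) c Q _) h
    ... | d , δ , δ∈ , le , hδ with ∈-add⁻ m P b ψ δ∈
    ...   | inj₁ δ∈m  = from (Sat-U 𝒜 I m c Q _) (d , δ , δ∈m , le , hδ)
    ...   | inj₂ refl = contradiction (ℕ.≤-<-trans le c<b) (ℕ.<-irrefl refl)

    U-add-new : ∀ {c} → b ≤ c → Sat I ψ ⊆ᴾ Sat I (U (add m P b ψ) (just c) P)
    U-add-new {c} b≤c h = from (Sat-U 𝒜 I (add m P b ψ) c P _) (b , ψ , ∈-add-new m P b ψ , b≤c , h)

    O-add-⊆ : ∀ c Q → Sat I (O (add m P b ψ) c Q) ⊆ᴾ Sat I (O m c Q)
    O-add-⊆ (just c) Q h = from (Sat-O 𝒜 I m c Q _) λ d δ δ∈ → to (Sat-O 𝒜 I (add m P b ψ) c Q _) h d δ (∈-add-old m P b ψ δ∈)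

    O-add-new : ∀ {c} → c ≤ b → Sat I (O (add m P b ψ) (just c) P) ⊆ᴾ Sat I ψ
    O-add-new {c} c≤b h = to (Sat-O 𝒜 I (add m P b ψ) c P _) h b ψ (∈-add-new m P b ψ) c≤b

-- Counting

module Counting (em : ∀ {a : Level} → ExcludedMiddle a) where

  count : {A : Set ℓ} → Pred A t → List A → ℕ
  count B []       = 0
  count B (x ∷ xs) = (if does (em {P = B x}) then 1 else 0) + count B xs

  module _ {A : Set ℓ} where

    count≤length : (B : Pred A t) → ∀ xs → count B xs ≤ length xs
    count≤length B []       = z≤n
    count≤length B (x ∷ xs) with em {P = B x}
    ... | yes _ = s≤s (count≤length B xs)
    ... | no _  = ℕ.m≤n⇒m≤1+n (count≤length B xs)

    module _ {B C : Pred A t} (B⊆C : B ⊆ᴾ C) where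

      count-monotone : ∀ xs → count B xs ≤ count C xs
      count-monotone []       = z≤n
      count-monotone (x ∷ xs) = ℕ.+-mono-≤ head (count-monotone xs)
        where
        head : (if does (em {P = B x}) then 1 else 0) ≤ (if does (em {P = C x}) then 1 else 0)
        head with em {P = B x} | em {P = C x}
        ... | no _  | _     = z≤n
        ... | yes _ | yes _ = ℕ.≤-refl
        ... | yes b | no ¬c = contradiction (B⊆C b) ¬c

      count-strict : ∀ {x xs} → x ∈ xs → C x → ¬ B x → count B xs < count C xs
      count-strict {x} {_ ∷ xs} (here refl) c ¬b with em {P = B x} | em {P = C x}
      ... | yes b | _     = contradiction b ¬b
      ... | no _  | yes _ = s≤s (count-monotone xs)
      ... | no _  | no ¬c = contradiction c ¬c
      count-strict {x} {y ∷ xs} (there x∈) c ¬b with em {P = B y} | em {P = C y}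
      ... | yes _ | yes _ = s≤s (count-strict x∈ c ¬b)
      ... | yes b | no ¬c = contradiction (B⊆C b) ¬c
      ... | no _  | yes _ = ℕ.m≤n⇒m≤1+n (count-strict x∈ c ¬b)
      ... | no _  | no _  = count-strict x∈ c ¬b

-- Sums over lists

module _ {A : Set ℓ} where

  total : (A → ℕ) → List A → ℕ
  total f xs = ListAction.sum (map f xs)

  module _ {f g : A → ℕ} (f≤g : ∀ x → f x ≤ g x) where

    total-monotone : ∀ xs → total f xs ≤ total g xs
    total-monotone []       = z≤n
    total-monotone (x ∷ xs) = ℕ.+-mono-≤ (f≤g x) (total-monotone xs)

    -- The drop `d` at one entry survives in the sum; later it pays for an entry put in front of the
    -- list.
    total-decrease : ∀ d {x xs} → x ∈ xs → d + f x ≤ g x → d + total f xs ≤ total g xs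
    total-decrease d {x} {_ ∷ xs} (here refl) h = begin
      d + (f x + total f xs)  ≡⟨ ℕ.+-assoc d (f x) (total f xs) ⟨
      d + f x + total f xs    ≤⟨ ℕ.+-mono-≤ h (total-monotone xs) ⟩
      g x + total g xs        ∎
      where open ℕ.≤-Reasoning
    total-decrease d {x} {y ∷ xs} (there x∈) h = begin
      d + (f y + total f xs)  ≡⟨ ℕ.+-comm d _ ⟩
      f y + total f xs + d    ≡⟨ ℕ.+-assoc (f y) (total f xs) d ⟩
      f y + (total f xs + d)  ≡⟨ cong (f y +_) (ℕ.+-comm (total f xs) d) ⟩
      f y + (d + total f xs)  ≤⟨ ℕ.+-mono-≤ (f≤g y) (total-decrease d x∈ h) ⟩
      g y + total g xs        ∎
      where open ℕ.≤-Reasoning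

  module _ (f : A → ℕ) {B : Pred A t} (B? : Decidable B) where

    total-filter-≤ : ∀ xs → total f (filter B? xs) ≤ total f xs
    total-filter-≤ []       = z≤n
    total-filter-≤ (x ∷ xs) with B? x
    ... | yes _ = ℕ.+-monoʳ-≤ (f x) (total-filter-≤ xs)
    ... | no _  = ℕ.≤-trans (total-filter-≤ xs) (ℕ.m≤n+m _ (f x))

    total-filter-< : ∀ {x xs} → x ∈ xs → ¬ B x → 0 < f x → total f (filter B? xs) < total f xs
    total-filter-< {x} {_ ∷ xs} (here refl) ¬b 0<fx with B? x
    ... | yes b = contradiction b ¬b
    ... | no _  = ℕ.+-mono-≤ 0<fx (total-filter-≤ xs)
    total-filter-< {x} {y ∷ xs} (there x∈) ¬b 0<fx with B? y
    ... | yes _ = ℕ.+-monoʳ-< (f y) (total-filter-< x∈ ¬b 0<fx)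
    ... | no _  = ℕ.≤-trans (total-filter-< x∈ ¬b 0<fx) (ℕ.m≤n+m _ (f y))

  minimise : (f : A → ℕ) → ∀ x xs → ∃[ y ] y ∈ x ∷ xs × (∀ {z} → z ∈ x ∷ xs → f y ≤ f z)
  minimise f x []       = x , here refl , λ { (here refl) → ℕ.≤-refl }
  minimise f x (y ∷ xs) with minimise f y xs
  ... | z , z∈ , least with ℕ.≤-total (f x) (f z)
  ...   | inj₁ x≤z = x , here refl , λ { (here refl) → ℕ.≤-refl ; (there w∈) → ℕ.≤-trans x≤z (least w∈) }
  ...   | inj₂ z≤x = z , there z∈ , λ { (here refl) → z≤x ; (there w∈) → least w∈ }

-- Soundness of the assertion maps

module Run (em : ∀ {a : Level} → ExcludedMiddle a) {s ℓ t : Level} {S : Signature s}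
           (Th : Theory S ℓ t) (valid? : ValidityTest Th) (𝒜 : Program S)
           (φ-safe : Formula S (Program.∣v∣ 𝒜 (Program.main 𝒜))) where

  open Classical em
  open Counting em
  open Program 𝒜
  open Semantics 𝒜
  open Maps 𝒜
  open Bounds em 𝒜
  open Algorithms Th valid? 𝒜 φ-safe

  Model : Structure S ℓ → Set _
  Model = IsModel (sentences Th)

  ⊭-witness : {θ χ : Formula S n} → ⊭ (θ ⇒′ χ) →
              Σ[ I ∈ Structure S ℓ ] Model I × ∃[ e ] Sat I θ e × ¬ Sat I χ e
  ⊭-witness invalid = by-contradiction λ none →
    invalid λ I mod e h → by-contradiction λ ¬χ → none (I , mod , e , h , ¬χ)

  ⊭¬-witness : {θ χ : Formula S n} → ⊭ (θ ⇒′ ¬′ χ) →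
               Σ[ I ∈ Structure S ℓ ] Model I × ∃[ e ] Sat I θ e × Sat I χ e
  ⊭¬-witness {θ = θ} {χ} invalid =
    let I , mod , e , h , ¬¬χ = ⊭-witness {θ = θ} {¬′ χ} invalid
    in I , mod , e , h , by-contradiction λ ¬χ → ¬¬χ λ hχ → contradiction hχ ¬χ

  ⊥-lower : {A : Set ℓ′} → Poly.⊥ {ℓ} → A
  ⊥-lower ()

  fact : Map → ℕ → ∀ P → Path P → Formula S (∣v∣ P)
  fact ρ b P π = ∃ⁿ (locals P) (⟦ conj π ⟧ρ ρ (b ⊖1))

  -- Bound `b` corresponds to index `suc b` of `iterate`: facts lie below that iterate and summaries
  -- above it. The bounds by `n` ensure that a summary contributing to `O σ (just n)` is stored
  -- exactly at `n`, where the inductiveness test looks for it.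
  record Sound (n : ℕ) (ρ σ : Map) : Set (s Level.⊔ Level.suc ℓ Level.⊔ t) where
    field
      ρ-bound : ∀ {P b δ} → (b , δ) ∈ ρ P → b ≤ n
      σ-bound : ∀ {P b δ} → (b , δ) ∈ σ P → b ≤ n
      ρ-sound : ∀ {P b δ} → (b , δ) ∈ ρ P → ∀ I → Model I → Sat I δ ⊆ᴾ iterate 𝒜 I (suc b) P
      σ-sound : ∀ {P b δ} → (b , δ) ∈ σ P → ∀ I → Model I → iterate 𝒜 I (suc b) P ⊆ᴾ Sat I δ

  open Sound

  module _ {n : ℕ} {ρ σ : Map} (sound : Sound n ρ σ) {I : Structure S ℓ} (mod : Model I) where

    U-sound : ∀ b P → Sat I (U ρ (b ⊖1) P) ⊆ᴾ iterate 𝒜 I b P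
    U-sound (suc b) P h =
      let c , δ , δ∈ , c≤b , hδ = to (Sat-U 𝒜 I ρ b P _) h
      in iterate-monotone 𝒜 I (s≤s c≤b) P (ρ-sound sound δ∈ I mod hδ)

    O-sound : ∀ b P → iterate 𝒜 I b P ⊆ᴾ Sat I (O σ (b ⊖1) P)
    O-sound (suc b) P h = from (Sat-O 𝒜 I σ b P _) λ c δ δ∈ b≤c →
      σ-sound sound δ∈ I mod (iterate-monotone 𝒜 I (s≤s b≤c) P h)

    fact-sound : ∀ b P {π} → Paths P π → Sat I (fact ρ b P π) ⊆ᴾ iterate 𝒜 I (suc b) P
    fact-sound b P {π} prime {a} h =
      let ls , h′ = to (Sat-∃ⁿ I (locals P) (⟦ conj π ⟧ρ ρ (b ⊖1)) a) h
      in ls , monotone I (λ Q → U-sound b Q) (body P) (callsPositive P)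
                (implicant-sound _ (ls ⧺ a) {body P} {quantifierFree P} (proj₁ prime) (to (Sat-instantiate 𝒜 I (U ρ (b ⊖1)) (conj π) _) h′))

    body-sound : ∀ b P (ψ : Formula S (∣v∣ P)) → ⊨ (⟦ body P ⟧σ σ (b ⊖1) ⇒′ _↑ {P} ψ) →
                 iterate 𝒜 I (suc b) P ⊆ᴾ Sat I ψ
    body-sound b P ψ valid {a} (ls , h) =
      to (Sat-↑ 𝒜 I P ψ ls a) (valid I mod (ls ⧺ a)
        (from (Sat-instantiate 𝒜 I (O σ (b ⊖1)) (body P) _)
          (monotone I (λ Q → O-sound b Q) (body P) (callsPositive P) h)))

  -- Inductiveness makes `O σ (just n)` a closed interpretation; it therefore contains the least one
  -- and inherits safety to it.
  inductive-safe : ∀ {n ρ σ} → Sound n ρ σ → ⊨ (O σ (just n) main ⇒′ φ-safe) → Inductive σ n →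
                   Safe Th main φ-safe
  inductive-safe {n} {ρ} {σ} sound valid ind I mod X (_ , least) {a} Xa =
    valid I mod a (least (λ P → Sat I (O σ (just n) P)) (Closed-intro 𝒜 I solution) main Xa)
    where
    solution : ∀ Q ls a → Sat (J I λ P → Sat I (O σ (just n) P)) (body Q) (ls ⧺ a) → Sat I (O σ (just n) Q) a
    solution Q ls a h = from (Sat-O 𝒜 I σ n Q a) λ c δ δ∈ n≤c → to (Sat-↑ 𝒜 I Q δ ls a)
      (All.lookup (ind Q)
        (from (∈-selection (ℕ._≟ n) (σ Q)) (c , δ∈ , ℕ.≤-antisym (σ-bound sound δ∈) n≤c))
        I mod (ls ⧺ a) (from (Sat-instantiate 𝒜 I (O σ (just n)) (body Q) _) h))

  push-sound : ∀ {n ρ σ} → Sound n ρ σ → Sound (suc n) ρ (push σ n)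
  push-sound {n} {ρ} {σ} sound = record
    { ρ-bound = ℕ.m≤n⇒m≤1+n ∘ ρ-bound sound
    ; ρ-sound = ρ-sound sound
    ; σ-bound = λ {P} {b} {δ} δ∈ → case split P δ∈ of λ
        { (inj₁ δ∈σ)        → ℕ.m≤n⇒m≤1+n (σ-bound sound δ∈σ)
        ; (inj₂ (refl , _)) → ℕ.≤-refl }
    ; σ-sound = λ {P} {b} {δ} δ∈ I mod → case split P δ∈ of λ
        { (inj₁ δ∈σ)            → σ-sound sound δ∈σ I mod
        -- `suc n ⊖1` is `just n`, the bound used by the pushing test.
        ; (inj₂ (refl , valid)) → body-sound sound mod (suc n) P δ valid }
    }
    where
    split : ∀ P {b δ} → (b , δ) ∈ push σ n P → (b , δ) ∈ σ P ⊎ (b ≡ suc n × Pushable σ n P δ)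
    split P δ∈ with ∈-++⁻ (map (suc n ,_) (filter _ ((σ at n) P))) δ∈
    ... | inj₂ δ∈σ = inj₁ δ∈σ
    ... | inj₁ new with ∈-map⁻ (suc n ,_) new
    ...   | δ , δ∈ , refl = inj₂ (refl , proj₂ (∈-filter⁻ _ {xs = (σ at n) P} δ∈))

  -- The query defines the image of `θ` under the argument terms.
  Sat-callQuery : ∀ (I : Structure S ℓ) P R as (θ : Formula S (∣vℓ∣ P)) a →
    Sat I (callQuery {P} R as θ) a ⇔ (∃[ e ] a ≡ evals (algebra I) e as × Sat I θ e)
  Sat-callQuery I P R as θ a = ⇔-trans (Sat-∃ⁿ I k _ a)
    (mk⇔ (λ (e , eqs , h) → e , trans (to (equations e) eqs) (arguments e) , to (weaken e) h)
         (λ (e , eq , h) → e , from (equations e) (trans eq (sym (arguments e))) , from (weaken e) h))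
    where
    k = ∣vℓ∣ P
    equations : ∀ e → _
    equations e = Sat-equations I (k ↑ʳ_) (as [ vars (_↑ˡ ∣v∣ R) ]ᵗˢ) (e ⧺ a) a (lookup-++ʳ e a)
    arguments : ∀ e → evals (algebra I) (e ⧺ a) (as [ vars (_↑ˡ ∣v∣ R) ]ᵗˢ) ≡ evals (algebra I) e as
    arguments e = trans (evals-[] (algebra I) (e ⧺ a) (vars (_↑ˡ ∣v∣ R)) as)
      (cong (λ e′ → evals (algebra I) e′ as)
        (evals-vars (algebra I) (e ⧺ a) (_↑ˡ ∣v∣ R) e (lookup-++ˡ e a)))
    weaken : ∀ e → Sat I (θ [ vars (_↑ˡ ∣v∣ R) ]) (e ⧺ a) ⇔ Sat I θ e
    weaken e = Sat-vars I θ (_↑ˡ ∣v∣ R) (e ⧺ a) e (lookup-++ˡ e a)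

  -- The invariant of a round

  Excluded Reached : ℕ → Map → Set _
  Reached  n ρ = ⊭ (U ρ (just n) main ⇒′ φ-safe)
  Excluded n σ = ⊨ (O σ (just n) main ⇒′ φ-safe)

  -- `disjoint` guarantees that a reach step derives something new. `goal` guarantees that a verdict
  -- is available once no query is left: the initial query disappears only after being reached or
  -- excluded.
  record Invariant (n : ℕ) (𝒬 : List Query) (ρ σ : Map) : Set (s Level.⊔ Level.suc ℓ Level.⊔ t) where
    field
      sound    : Sound n ρ σ
      bound≤   : ∀ {P φ b} → ⟨ P , φ , b ⟩ ∈ 𝒬 → b ≤ n
      disjoint : ∀ {P φ b} → ⟨ P , φ , b ⟩ ∈ 𝒬 → ⊨ (U ρ (just b) P ⇒′ ¬′ φ)
      goal     : ⟨ main , ¬′ φ-safe , n ⟩ ∈ 𝒬 ⊎ Reached n ρ ⊎ Excluded n σ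

  open Invariant

  init-invariant : ∀ {n ρ σ} → Sound n ρ σ → ⊨ (U ρ (just n) main ⇒′ φ-safe) →
                   Invariant n (⟨ main , ¬′ φ-safe , n ⟩ ∷ []) ρ σ
  init-invariant snd valid = record
    { sound    = snd
    ; bound≤   = λ { (here refl) → ℕ.≤-refl }
    ; disjoint = λ { (here refl) I mod a h ¬φ → ¬φ (valid I mod a h) }
    ; goal     = inj₁ (here refl)
    }

  retained-or-deleted : {D : Pred Query ℓ′} (D? : Decidable D) {𝒬 : List Query} {q : Query} → q ∈ 𝒬 →
                        q ∈ filter (¬? ∘ D?) 𝒬 ⊎ D q
  retained-or-deleted D? {q = q} q∈ with D? q
  ... | yes d = inj₂ d
  ... | no ¬d = inj₁ (∈-filter⁺ (¬? ∘ D?) q∈ ¬d)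

  retained : {D : Pred Query ℓ′} (D? : Decidable D) {𝒬 : List Query} {q : Query} →
             q ∈ filter (¬? ∘ D?) 𝒬 → q ∈ 𝒬 × ¬ D q
  retained D? = ∈-filter⁻ (¬? ∘ D?)

  sum-invariant : ∀ {n 𝒬 ρ σ P φ b} (ψ : Formula S (∣v∣ P)) → ⟨ P , φ , b ⟩ ∈ 𝒬 →
    ⊨ (⟦ body P ⟧σ σ (b ⊖1) ⇒′ _↑ {P} ψ) →
    Invariant n 𝒬 ρ σ → Invariant n (filter (¬? ∘ sumDeletes? σ P ψ b) 𝒬) ρ (add σ P b ψ)
  sum-invariant {n} {𝒬} {ρ} {σ} {P} {φ} {b} ψ q∈ β⇒ψ inv = record
    { sound = record
        { ρ-bound = ρ-bound (sound inv)
        ; ρ-sound = ρ-sound (sound inv)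
        ; σ-bound = λ δ∈ → case ∈-add⁻ σ P b ψ δ∈ of λ
            { (inj₁ δ∈σ)  → σ-bound (sound inv) δ∈σ
            ; (inj₂ refl) → bound≤ inv q∈ }
        ; σ-sound = λ δ∈ I mod → case ∈-add⁻ σ P b ψ δ∈ of λ
            { (inj₁ δ∈σ)  → σ-sound (sound inv) δ∈σ I mod
            ; (inj₂ refl) → body-sound (sound inv) mod b P ψ β⇒ψ }
        }
    ; bound≤   = bound≤ inv ∘ proj₁ ∘ retained (sumDeletes? σ P ψ b)
    ; disjoint = disjoint inv ∘ proj₁ ∘ retained (sumDeletes? σ P ψ b)
    ; goal     = goal′ (goal inv)
    }
    where
    goal′ : ⟨ main , ¬′ φ-safe , n ⟩ ∈ 𝒬 ⊎ Reached n ρ ⊎ Excluded n σ →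
            ⟨ main , ¬′ φ-safe , n ⟩ ∈ filter (¬? ∘ sumDeletes? σ P ψ b) 𝒬
              ⊎ Reached n ρ ⊎ Excluded n (add σ P b ψ)
    goal′ (inj₁ main∈) with retained-or-deleted (sumDeletes? σ P ψ b) main∈
    ... | inj₁ kept = inj₁ kept
    -- The new over-approximation lies inside both the old one and `ψ`, which together refute the
    -- deleted initial query.
    ... | inj₂ (deletes n≤b valid) = inj₂ (inj₂ λ I mod a h → by-contradiction λ ¬φ →
            ⊥-lower (valid I mod a (O-add-⊆ I σ P b ψ (just n) P h , O-add-new I σ P b ψ n≤b h)
                           λ hφ → contradiction hφ ¬φ))
    goal′ (inj₂ (inj₁ reached))  = inj₂ (inj₁ reached)
    goal′ (inj₂ (inj₂ excluded)) = inj₂ (inj₂ λ I mod a h →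
      excluded I mod a (O-add-⊆ I σ P b ψ (just n) main h))

  reach-invariant : ∀ {n 𝒬 ρ σ P φ b} (π : Path P) → ⟨ P , φ , b ⟩ ∈ 𝒬 → Paths P π →
    Invariant n 𝒬 ρ σ →
    Invariant n (filter (¬? ∘ reachDeletes? P (fact ρ b P π) b) 𝒬) (add ρ P b (fact ρ b P π)) σ
  reach-invariant {n} {𝒬} {ρ} {σ} {P} {φ} {b} π q∈ prime inv = record
    { sound = record
        { ρ-bound = λ δ∈ → case ∈-add⁻ ρ P b ψ δ∈ of λ
            { (inj₁ δ∈ρ)  → ρ-bound (sound inv) δ∈ρ
            ; (inj₂ refl) → bound≤ inv q∈ }
        ; ρ-sound = λ δ∈ I mod → case ∈-add⁻ ρ P b ψ δ∈ of λ
            { (inj₁ δ∈ρ)  → ρ-sound (sound inv) δ∈ρ I mod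
            ; (inj₂ refl) → fact-sound (sound inv) mod b P prime }
        ; σ-bound = σ-bound (sound inv)
        ; σ-sound = σ-sound (sound inv)
        }
    ; bound≤   = bound≤ inv ∘ proj₁ ∘ retained (reachDeletes? P ψ b)
    ; disjoint = λ q∈′ → let q∈ , kept = retained (reachDeletes? P ψ b) q∈′ in disjoint′ q∈ kept
    ; goal     = goal′ (goal inv)
    }
    where
    ψ = fact ρ b P π
    disjoint′ : ∀ {Q η c} → ⟨ Q , η , c ⟩ ∈ 𝒬 → ¬ ReachDeletes P ψ b ⟨ Q , η , c ⟩ →
                ⊨ (U (add ρ P b ψ) (just c) Q ⇒′ ¬′ η)
    disjoint′ {Q} {η} {c} q∈ kept I mod a h hη with to (Sat-U 𝒜 I (add ρ P b ψ) c Q a) h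
    ... | d , δ , δ∈ , d≤c , hδ with ∈-add⁻ ρ P b ψ δ∈
    ...   | inj₁ δ∈ρ  = disjoint inv q∈ I mod a (from (Sat-U 𝒜 I ρ c Q a) (d , δ , δ∈ρ , d≤c , hδ)) hη
    -- A query of bound at least `b` that meets the new fact has been deleted, so a survivor cannot
    -- meet it.
    ...   | inj₂ refl = contradiction (deletes d≤c λ valid → ⊥-lower (valid I mod a hδ hη)) kept
    goal′ : ⟨ main , ¬′ φ-safe , n ⟩ ∈ 𝒬 ⊎ Reached n ρ ⊎ Excluded n σ →
            ⟨ main , ¬′ φ-safe , n ⟩ ∈ filter (¬? ∘ reachDeletes? P ψ b) 𝒬
              ⊎ Reached n (add ρ P b ψ) ⊎ Excluded n σ
    goal′ (inj₁ main∈) with retained-or-deleted (reachDeletes? P ψ b) main∈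
    ... | inj₁ kept = inj₁ kept
    ... | inj₂ (deletes b≤n invalid) = inj₂ (inj₁ λ valid → invalid λ I mod a h ¬φ →
            ¬φ (valid I mod a (U-add-new I ρ P b ψ b≤n h)))
    goal′ (inj₂ (inj₁ reached))  = inj₂ (inj₁ λ valid → reached λ I mod a h →
      valid I mod a (U-add-⊇ I ρ P b ψ (just n) main h))
    goal′ (inj₂ (inj₂ excluded)) = inj₂ (inj₂ excluded)

  module _ {ρ σ : Map} {P : Proc} {φ : Formula S (∣v∣ P)} {c : ℕ} (u v : Path P)
           (R : Proc) (as : Vec (Term (functions S) (∣vℓ∣ P)) (∣v∣ R)) where

    callContext : Formula S (∣vℓ∣ P)
    callContext = ⟦ conj u ⟧σ σ (just c) ∧′ ⟦ conj v ⟧ρ ρ (just c) ∧′ _↑ {P} φ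

    query-invariant : ∀ {n 𝒬} → ⟨ P , φ , suc c ⟩ ∈ 𝒬 →
      ⊨ (⟦ conj u ⟧σ σ (just c) ∧′ ⟦ atom (call R as) ⟧ρ ρ (just c) ∧′ ⟦ conj v ⟧ρ ρ (just c) ⇒′ ¬′ (_↑ {P} φ)) →
      Invariant n 𝒬 ρ σ →
      Invariant n (⟨ R , callQuery {P} R as callContext , c ⟩ ∷ 𝒬) ρ σ
    query-invariant q∈ blocked inv = record
      { sound    = sound inv
      ; bound≤   = λ { (here refl) → ℕ.≤-trans (ℕ.n≤1+n c) (bound≤ inv q∈) ; (there q∈′) → bound≤ inv q∈′ }
      ; disjoint = λ
          -- A reachable tuple of the callee inside the new query would satisfy the conjunction that
          -- `blocked` refutes.
          { (here refl) I mod a hU hψ →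
              let e , a≡ , hu , hv , hφ = to (Sat-callQuery I P R as callContext a) hψ
              in blocked I mod e (hu , from (Sat-[] I (U ρ (just c) R) as e)
                                         (subst (Sat I (U ρ (just c) R)) a≡ hU) , hv) hφ
          ; (there q∈′) → disjoint inv q∈′ }
      ; goal     = case goal inv of λ { (inj₁ main∈) → inj₁ (there main∈) ; (inj₂ g) → inj₂ g }
      }

  -- Progress

  Sat-conj-++ : ∀ (I : Structure S ℓ) (Φ : ∀ Q → Formula S (∣v∣ Q)) (u : List (Literal (S ⊕ ∣v∣) n)) {v e} →
    Sat I (instantiate Φ (conj (u ++ v))) e ⇔ (Sat I (instantiate Φ (conj u)) e × Sat I (instantiate Φ (conj v)) e)
  Sat-conj-++ I Φ []      = mk⇔ (λ h → id , h) proj₂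
  Sat-conj-++ I Φ (l ∷ u) = mk⇔
    (λ (h , hs) → let hu , hv = to (Sat-conj-++ I Φ u) hs in (h , hu) , hv)
    (λ ((h , hu) , hv) → h , from (Sat-conj-++ I Φ u) (hu , hv))

  -- Moving the boundary between summaries (on the left) and reachability facts (on the right)
  -- through a path, the first literal at which the conjunction becomes satisfiable is a call.
  record Split (ρ σ : Map) {P : Proc} (φ : Formula S (∣v∣ P)) (c : ℕ) (π : Path P) :
               Set (s Level.⊔ Level.suc ℓ Level.⊔ t) where
    constructor splitting
    field
      prefix suffix : Path P
      callee        : Proc
      arguments     : Vec (Term (functions S) (∣vℓ∣ P)) (∣v∣ callee)
      splits        : π ≡ prefix ++ pos (call callee arguments) ∷ suffix
      blocked       : ⊨ (⟦ conj prefix ⟧σ σ (just c) ∧′ ⟦ atom (call callee arguments) ⟧ρ ρ (just c)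
                           ∧′ ⟦ conj suffix ⟧ρ ρ (just c) ⇒′ ¬′ (_↑ {P} φ))
      open′         : ⊭ (⟦ conj prefix ⟧σ σ (just c) ∧′ ⟦ atom (call callee arguments) ⟧σ σ (just c)
                           ∧′ ⟦ conj suffix ⟧ρ ρ (just c) ⇒′ ¬′ (_↑ {P} φ))

  module _ {ρ σ : Map} {P : Proc} {φ : Formula S (∣v∣ P)} {c : ℕ} where

    -- The recursion keeps the conjunction with `u` under `σ` and `v` under `ρ` incompatible with
    -- the query. It must stop before `v` is exhausted, since the whole path under `σ` is compatible
    -- with it.
    find-split : ∀ u v → Paths P (u ++ v) →
      ⊨ (⟦ conj u ⟧σ σ (just c) ∧′ ⟦ conj v ⟧ρ ρ (just c) ⇒′ ¬′ (_↑ {P} φ)) →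
      ⊭ (⟦ conj (u ++ v) ⟧σ σ (just c) ⇒′ ¬′ (_↑ {P} φ)) → Split ρ σ φ c (u ++ v)
    find-split u [] prime blocked open′ = contradiction
      (λ I mod e h → blocked I mod e (proj₁ (to (Sat-conj-++ I (O σ (just c)) u) h) , id)) open′
    find-split u (l ∷ v) prime blocked open′
      with em {P = ⊨ (⟦ conj (u ++ l ∷ []) ⟧σ σ (just c) ∧′ ⟦ conj v ⟧ρ ρ (just c) ⇒′ ¬′ (_↑ {P} φ))}
    ... | yes blocked′ = subst (Split ρ σ φ c) assoc
            (find-split (u ++ l ∷ []) v (subst (Paths P) (sym assoc) prime) blocked′
              (subst (λ π → ⊭ (⟦ conj π ⟧σ σ (just c) ⇒′ ¬′ (_↑ {P} φ))) (sym assoc) open′))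
      where
      assoc : (u ++ l ∷ []) ++ v ≡ u ++ l ∷ v
      assoc = ++-assoc u (l ∷ []) v
    ... | no open″ = found l refl
      where
      opened : ⊭ (⟦ conj u ⟧σ σ (just c) ∧′ ⟦ literal l ⟧σ σ (just c) ∧′ ⟦ conj v ⟧ρ ρ (just c) ⇒′ ¬′ (_↑ {P} φ))
      opened valid = open″ λ I mod e (hul , hv) →
        let hu , hl , _ = to (Sat-conj-++ I (O σ (just c)) u) hul in valid I mod e (hu , hl , hv)
      -- A literal without calls reads the same under both maps, so moving it across the boundary
      -- cannot open the conjunction.
      unchanged : ⟦ literal l ⟧σ σ (just c) ≡ ⟦ literal l ⟧ρ ρ (just c) → Split ρ σ φ c (u ++ l ∷ v)
      unchanged eq = contradiction (λ I mod e (hu , hl , hv) →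
        blocked I mod e (hu , subst (λ χ → Sat I χ e) eq hl , hv)) opened
      found : ∀ l′ → l ≡ l′ → Split ρ σ φ c (u ++ l ∷ v)
      found (pos (_ ≐ _))           refl = unchanged refl
      found (pos (rel (inj₁ _) _))  refl = unchanged refl
      found (pos (rel (inj₂ R) as)) refl = splitting u v R as refl blocked opened
      found (neg (_ ≐ _))           refl = unchanged refl
      found (neg (rel (inj₁ _) _))  refl = unchanged refl
      found (neg (rel (inj₂ R) as)) refl = ⊥-elim (proj₁ (All.lookup
        (to (CallsPositive-conj (u ++ l ∷ v)) (prime-callsPositive P prime)) (∈-++⁺ʳ u (here refl))))

  -- With `body-of-path`, an instantiated body is equivalent to the disjunction of its instantiated
  -- paths: calls are propositional atoms in the expansion `J`.
  path-of-body : ∀ P {Φ : ∀ Q → Formula S (∣v∣ Q)} {I : Structure S ℓ} {e} → Sat I (instantiate Φ (body P)) e →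
                 ∃[ π ] Paths P π × Sat I (instantiate Φ (conj π)) e
  path-of-body P {Φ} {I} {e} h =
    let π , prime , hπ = prime-complete (J I λ Q → Sat I (Φ Q)) e (body P) (quantifierFree P)
                           (to (Sat-instantiate 𝒜 I Φ (body P) e) h)
    in π , prime , from (Sat-instantiate 𝒜 I Φ (conj π) e) hπ

  body-of-path : ∀ P {Φ : ∀ Q → Formula S (∣v∣ Q)} {I : Structure S ℓ} {e π} → Paths P π →
                 Sat I (instantiate Φ (conj π)) e → Sat I (instantiate Φ (body P)) e
  body-of-path P {Φ} {I} {e} {π} prime h = from (Sat-instantiate 𝒜 I Φ (body P) e)
    (implicant-sound _ e {body P} {quantifierFree P} (proj₁ prime) (to (Sat-instantiate 𝒜 I Φ (conj π) e) h))

  progress : ∀ {n 𝒬 ρ σ} → Invariant n 𝒬 ρ σ → ∃[ c ] BndSafety n (𝒬 ∥ ρ ∥ σ) c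
  progress {𝒬 = []} inv with goal inv
  ... | inj₂ (inj₁ reached)  = _ , unsafe reached
  ... | inj₂ (inj₂ excluded) = _ , safe excluded
  progress {𝒬 = q₀ ∷ 𝒬} {ρ} {σ} inv with minimise Query.bound q₀ 𝒬
  ... | ⟨ P , φ , b ⟩ , q∈ , least
    with em {P = ⊨ (⟦ body P ⟧σ σ (b ⊖1) ⇒′ ¬′ (_↑ {P} φ))}
  -- The negated query itself serves as the interpolant.
  ... | yes summarised = _ , sum (¬′ φ) q∈ summarised summarised λ I mod a h → h
  ... | no ¬summarised
    with em {P = ⊨ (⟦ body P ⟧ρ ρ (b ⊖1) ⇒′ ¬′ (_↑ {P} φ))}
  ... | no ¬blocked =
    let I , mod , e , h , hφ = ⊭¬-witness {θ = ⟦ body P ⟧ρ ρ (b ⊖1)} {_↑ {P} φ} ¬blocked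
        π , prime , hπ = path-of-body P h
    in _ , reach π q∈ prime λ valid → ⊥-lower (valid I mod e hπ hφ)
  progress {𝒬 = q₀ ∷ 𝒬} inv | ⟨ P , φ , zero ⟩ , q∈ , least | no ¬summarised | yes blocked =
    -- At bound 0 both maps instantiate every call by falsity, so the two tests coincide.
    contradiction blocked ¬summarised
  progress {𝒬 = q₀ ∷ 𝒬} {ρ} {σ} inv | ⟨ P , φ , suc c ⟩ , q∈ , least | no ¬summarised | yes blocked =
    let I , mod , e , h , hφ = ⊭¬-witness {θ = ⟦ body P ⟧σ σ (just c)} {_↑ {P} φ} ¬summarised
        π , prime , hπ = path-of-body P h
        splitting u v R as eq blocked′ open′ = find-split {ρ} {σ} {P} {φ} {c} [] π prime
          (λ I mod e (_ , hπ) → blocked I mod e (body-of-path P prime hπ))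
          (λ valid → ⊥-lower (valid I mod e hπ hφ))
    in _ , query u v R as q∈ blocked (subst (Paths P) eq prime) blocked′ open′
             -- The chosen query has least bound `suc c`, so no query of bound `c` can conflict with
             -- the new one.
             (λ η η∈ → contradiction (least η∈) ℕ.1+n≰n)

  -- Termination

  words-of : ∀ P → List (Path P)
  words-of P = words (length (literals {φ = body P} {quantifierFree P})) (literals {φ = body P} {quantifierFree P})

  path∈words : ∀ {P π} → Paths P π → ∀ w → w ⊑ π → w ∈ words-of P
  path∈words {P} prime w w⊑π = ∈-words _
    (All-resp-⊆ w⊑π (prime-literals {φ = body P} {quantifierFree P} prime))
    (ℕ.≤-trans (length-mono-≤ w⊑π) (prime-length-≤ {φ = body P} {quantifierFree P} prime))

  paths : List (Σ Proc Path)
  paths = concatMap (λ P → map (P ,_) (words-of P)) (allFin _)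

  ∈-paths : ∀ {P π} → Paths P π → (P , π) ∈ paths
  ∈-paths {P} prime = ∈-concatMap⁺ (λ P → map (P ,_) (words-of P))
    (Any.map (λ { refl → ∈-map⁺ (P ,_) (path∈words prime _ ⊆-refl) }) (∈-allFin P))

  MarkedPath : Proc → Set s
  MarkedPath P = Path P × Literal (S ⊕ ∣v∣) (∣vℓ∣ P) × Path P

  -- A finite superset of the positions in prime implicants at which a query can be posed.
  markedPaths : List (Σ Proc MarkedPath)
  markedPaths = concatMap (λ P → map (P ,_) (marked P)) (allFin _)
    where
    marked : ∀ P → List (MarkedPath P)
    marked P = cartesianProduct (words-of P)
                 (cartesianProduct (literals {φ = body P} {quantifierFree P}) (words-of P))

  ∈-markedPaths : ∀ {P u l v} → Paths P (u ++ l ∷ v) → (P , u , l , v) ∈ markedPaths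
  ∈-markedPaths {P} {u} {l} {v} prime = ∈-concatMap⁺ _
    (Any.map (λ { refl → ∈-map⁺ (P ,_) (∈-cartesianProduct⁺ (path∈words prime u (++⁺ʳ (l ∷ v) ⊆-refl))
      (∈-cartesianProduct⁺ (All.lookup (prime-literals {φ = body P} {quantifierFree P} prime) (∈-++⁺ʳ u (here refl)))
        (path∈words prime v (++⁺ˡ u (l ∷ʳ ⊆-refl))))) }) (∈-allFin P))

  -- Positivity of the calls makes `fact` monotone in the map; with it, missing facts stay
  -- comparable when `ρ` grows.
  data Missing (ρ : Map) (b : ℕ) : Pred (Σ Proc Path) (s Level.⊔ Level.suc ℓ Level.⊔ t) where
    missing : ∀ {P π} → CallsPositive (conj π) → ⊭ (fact ρ b P π ⇒′ U ρ (just b) P) → Missing ρ b (P , π)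

  -- The numbers of missing facts at the bounds 0, …, b as digits, so that < is lexicographic.
  rank : Map → ℕ → ℕ
  rank ρ zero    = count (Missing ρ 0) paths
  rank ρ (suc b) = rank ρ b * suc (length paths) + count (Missing ρ (suc b)) paths

  module _ {ρ : Map} {b : ℕ} {P : Proc} {φ : Formula S (∣v∣ P)} {π : Path P} (prime : Paths P π)
           (disj : ⊨ (U ρ (just b) P ⇒′ ¬′ φ)) (new : ⊭ (⟦ conj π ⟧ρ ρ (b ⊖1) ⇒′ ¬′ (_↑ {P} φ))) where

    private
      ρ′ : Map
      ρ′ = add ρ P b (fact ρ b P π)

      -- A fact stored at `b` is invisible at the smaller bound `c ⊖1`; hence facts derived at
      -- bounds up to `b` do not grow.
      U-shrinks : ∀ (I : Structure S ℓ) {c} → c ≤ b → ∀ Q → Sat I (U ρ′ (c ⊖1) Q) ⊆ᴾ Sat I (U ρ (c ⊖1) Q)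
      U-shrinks I {suc c} c<b Q h = U-add-⊆ I ρ P b (fact ρ b P π) c<b Q h

      fact-shrinks : ∀ (I : Structure S ℓ) {c} → c ≤ b → ∀ Q ϖ → CallsPositive (conj ϖ) →
                     Sat I (fact ρ′ c Q ϖ) ⊆ᴾ Sat I (fact ρ c Q ϖ)
      fact-shrinks I {c} c≤b Q ϖ cp {a} h =
        let ls , h′ = to (Sat-∃ⁿ I (locals Q) (⟦ conj ϖ ⟧ρ ρ′ (c ⊖1)) a) h
        in from (Sat-∃ⁿ I (locals Q) (⟦ conj ϖ ⟧ρ ρ (c ⊖1)) a)
             (ls , instantiate-monotone 𝒜 I (λ R → U-shrinks I c≤b R) (conj ϖ) cp h′)

      missing-shrinks : ∀ {c} → c ≤ b → Missing ρ′ c ⊆ᴾ Missing ρ c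
      missing-shrinks {c} c≤b (missing {Q} {ϖ} cp fails) = missing cp λ valid → fails λ I mod a h →
        U-add-⊇ I ρ P b (fact ρ b P π) (just c) Q (valid I mod a (fact-shrinks I c≤b Q ϖ cp h))

      -- Were the fact already implied at `b`, it would be disjoint from the query, yet the reach
      -- step found them to overlap.
      was-missing : Missing ρ b (P , π)
      was-missing = missing (prime-callsPositive P prime) λ valid → new λ I mod e h hφ →
        case Vec.splitAt (locals P) e of λ
          { (ls , a , refl) → disj I mod a
              (valid I mod a (from (Sat-∃ⁿ I (locals P) (⟦ conj π ⟧ρ ρ (b ⊖1)) a) (ls , h)))
              (to (Sat-↑ 𝒜 I P φ ls a) hφ) }

      not-missing : ¬ Missing ρ′ b (P , π)
      not-missing (missing cp fails) = fails λ I mod a h →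
        U-add-new I ρ P b (fact ρ b P π) ℕ.≤-refl (fact-shrinks I ℕ.≤-refl P π cp h)

      count-shrinks : count (Missing ρ′ b) paths < count (Missing ρ b) paths
      count-shrinks = count-strict (missing-shrinks ℕ.≤-refl) (∈-paths prime) was-missing not-missing

      rank-below : ∀ {c} → c ≤ b → rank ρ′ c ≤ rank ρ c
      rank-below {zero}  c≤b = count-monotone (missing-shrinks c≤b) paths
      rank-below {suc c} c≤b = ℕ.+-mono-≤ (ℕ.*-monoˡ-≤ (suc (length paths)) (rank-below (ℕ.<⇒≤ c≤b)))
                                          (count-monotone (missing-shrinks c≤b) paths)

      rank-at : ∀ c → c ≡ b → rank ρ′ c < rank ρ c
      rank-at zero    refl = count-shrinks
      rank-at (suc c) refl = ℕ.+-mono-≤-<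
        (ℕ.*-monoˡ-≤ (suc (length paths)) (rank-below (ℕ.n≤1+n c))) count-shrinks

    -- Digits below `b` do not grow and the digit at `b` drops. Digits above `b` may grow, since the
    -- new fact can feed callers at larger bounds, but they are less significant.
    reach-rank : ∀ {c} → b ≤′ c → rank ρ′ c < rank ρ c
    reach-rank ≤′-refl = rank-at b refl
    reach-rank {suc c} (≤′-step b≤c) = begin-strict
      -- A digit is at most `k`, hence below the base `suc k`, so it cannot offset a drop in front
      -- of it.
      rank ρ′ c * suc k + count (Missing ρ′ (suc c)) paths  <⟨ ℕ.+-monoʳ-< _ (s≤s (count≤length _ paths)) ⟩
      rank ρ′ c * suc k + suc k                             ≡⟨ ℕ.+-comm (rank ρ′ c * suc k) (suc k) ⟩
      suc (rank ρ′ c) * suc k                               ≤⟨ ℕ.*-monoˡ-≤ (suc k) (reach-rank b≤c) ⟩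
      rank ρ c * suc k                                      ≤⟨ ℕ.m≤m+n _ _ ⟩
      rank ρ c * suc k + count (Missing ρ (suc c)) paths    ∎
      where
      open ℕ.≤-Reasoning
      k = length paths

  -- The rule query demands that the new query be disjoint from each η.  Here it is only not contained
  -- in any η, because containment persists when σ is strengthened, and overlap need not.
  data Fresh (𝒬 : List Query) (ρ σ : Map) : Query → Pred (Σ Proc MarkedPath) (s Level.⊔ Level.suc ℓ Level.⊔ t) where
    fresh : ∀ {P φ c u v R as} →
      Paths P (u ++ pos (call R as) ∷ v) →
      ⊭ (⟦ conj u ⟧σ σ (just c) ∧′ ⟦ atom (call R as) ⟧σ σ (just c) ∧′ ⟦ conj v ⟧ρ ρ (just c) ⇒′ ¬′ (_↑ {P} φ)) →
      (∀ {η} → ⟨ R , η , c ⟩ ∈ 𝒬 → ⊭ (callQuery {P} R as (callContext {ρ} {σ} {P} {φ} {c} u v R as) ⇒′ η)) →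
      Fresh 𝒬 ρ σ ⟨ P , φ , suc c ⟩ (P , u , pos (call R as) , v)

  -- Counts the query itself and, for each of its j fresh calls, the cost of the query that it spawns.
  cost : ℕ → ℕ → ℕ
  cost zero    j = 1
  cost (suc b) j = suc (j * suc (cost b (length markedPaths)))

  cost-positive : ∀ b j → 0 < cost b j
  cost-positive zero    j = s≤s z≤n
  cost-positive (suc b) j = s≤s z≤n

  cost-monotone : ∀ b {i j} → i ≤ j → cost b i ≤ cost b j
  cost-monotone zero    i≤j = ℕ.≤-refl
  cost-monotone (suc b) i≤j = s≤s (ℕ.*-monoˡ-≤ (suc (cost b (length markedPaths))) i≤j)

  -- One fresh call fewer releases the largest possible cost of the spawned query, plus one that
  -- makes the total strictly smaller.
  cost-strict : ∀ b {i j} → i < j → suc (cost b (length markedPaths)) + cost (suc b) i ≤ cost (suc b) j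
  cost-strict b {i} {j} i<j = begin
    suc k + suc (i * suc k)  ≡⟨ ℕ.+-suc (suc k) (i * suc k) ⟩
    suc (suc i * suc k)      ≤⟨ s≤s (ℕ.*-monoˡ-≤ (suc k) i<j) ⟩
    suc (j * suc k)          ∎
    where
    open ℕ.≤-Reasoning
    k = cost b (length markedPaths)

  queryCost : List Query → Map → Map → Query → ℕ
  queryCost 𝒬 ρ σ q = cost (Query.bound q) (count (Fresh 𝒬 ρ σ q) markedPaths)

  weight : List Query → Map → Map → ℕ
  weight 𝒬 ρ σ = total (queryCost 𝒬 ρ σ) 𝒬

  queryCost-monotone : ∀ {𝒬 𝒬′ ρ σ σ′} → (∀ q → Fresh 𝒬′ ρ σ′ q ⊆ᴾ Fresh 𝒬 ρ σ q) →
                       ∀ q → queryCost 𝒬′ ρ σ′ q ≤ queryCost 𝒬 ρ σ q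
  queryCost-monotone shrinks q = cost-monotone (Query.bound q) (count-monotone (shrinks q) markedPaths)

  module _ {𝒬 : List Query} {ρ σ : Map} {P : Proc} {φ : Formula S (∣v∣ P)} {b : ℕ}
           (ψ : Formula S (∣v∣ P)) (q∈ : ⟨ P , φ , b ⟩ ∈ 𝒬) (ψ⇒¬φ : ⊨ (ψ ⇒′ ¬′ φ)) where

    private
      σ′ : Map
      σ′ = add σ P b ψ
      𝒬′ : List Query
      𝒬′ = filter (¬? ∘ sumDeletes? σ P ψ b) 𝒬

    -- A stronger `σ` only shrinks call queries, so containment in a retained query persists. A call
    -- settled by a deleted query remains settled because the new summary blocks it.
    sum-fresh : ∀ q → Fresh 𝒬′ ρ σ′ q ⊆ᴾ Fresh 𝒬 ρ σ q
    sum-fresh _ (fresh {P′} {φ′} {c} {u} {v} {R} {as} prime open′ unasked) =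
      fresh prime (λ valid → open′ λ I mod e (hu , hR , hv) → valid I mod e (prefix I hu , argument I hR , hv)) asked
      where
      positive : CallsPositive (conj u)
      positive = from (CallsPositive-conj u)
        (All.++⁻ˡ u (to (CallsPositive-conj (u ++ _)) (prime-callsPositive P′ prime)))
      prefix : ∀ I {e} → Sat I (⟦ conj u ⟧σ σ′ (just c)) e → Sat I (⟦ conj u ⟧σ σ (just c)) e
      prefix I = instantiate-monotone 𝒜 I (λ Q → O-add-⊆ I σ P b ψ (just c) Q) (conj u) positive
      argument : ∀ I {e} → Sat I (⟦ atom (call R as) ⟧σ σ′ (just c)) e → Sat I (⟦ atom (call R as) ⟧σ σ (just c)) e
      argument I = instantiate-monotone 𝒜 I {Φ = O σ′ (just c)} {O σ (just c)} (λ Q → O-add-⊆ I σ P b ψ (just c) Q) (atom (call R as)) tt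
      context′ = callContext {ρ} {σ′} {P′} {φ′} {c} u v R as
      context  = callContext {ρ} {σ} {P′} {φ′} {c} u v R as
      asked : ∀ {η} → ⟨ R , η , c ⟩ ∈ 𝒬 → ⊭ (callQuery {P′} R as context ⇒′ η)
      asked {η} η∈ valid with retained-or-deleted (sumDeletes? σ P ψ b) η∈
      ... | inj₁ kept = unasked kept λ I mod a h →
        let e , a≡ , hu , hv , hφ = to (Sat-callQuery I P′ R as context′ a) h
        in valid I mod a (from (Sat-callQuery I P′ R as context a) (e , a≡ , prefix I hu , hv , hφ))
      -- The argument tuple lies in the new over-approximation, hence in `ψ`, and also in the
      -- deleted query that `ψ` helps to refute.
      ... | inj₂ (deletes c≤b refuted) = open′ λ I mod e (hu , hR , hv) hφ →
        let a = evals (algebra I) e as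
            hO = to (Sat-[] I (O σ′ (just c) P) as e) hR
        in refuted I mod a (O-add-⊆ I σ P b ψ (just c) P hO , O-add-new I σ P b ψ c≤b hO)
             (valid I mod a (from (Sat-callQuery I P′ R as context a) (e , refl , prefix I hu , hv , hφ)))

    sum-weight : weight 𝒬′ ρ σ′ < weight 𝒬 ρ σ
    sum-weight = ℕ.<-≤-trans
      (total-filter-< (queryCost 𝒬′ ρ σ′) (¬? ∘ sumDeletes? σ P ψ b) q∈
        -- The selected query is itself deleted, since `ψ` refutes it, and its cost is positive.
        (contradiction (deletes ℕ.≤-refl λ I mod a (_ , hψ) → ψ⇒¬φ I mod a hψ)) (cost-positive b _))
      (total-monotone (queryCost-monotone sum-fresh) 𝒬)

  module _ {𝒬 : List Query} {ρ σ : Map} {P : Proc} {φ : Formula S (∣v∣ P)} {c : ℕ} (u v : Path P)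
           (R : Proc) (as : Vec (Term (functions S) (∣vℓ∣ P)) (∣v∣ R)) (q∈ : ⟨ P , φ , suc c ⟩ ∈ 𝒬)
           (prime : Paths P (u ++ pos (call R as) ∷ v))
           (open′ : ⊭ (⟦ conj u ⟧σ σ (just c) ∧′ ⟦ atom (call R as) ⟧σ σ (just c) ∧′ ⟦ conj v ⟧ρ ρ (just c)
                        ⇒′ ¬′ (_↑ {P} φ)))
           (unasked : ∀ η → ⟨ R , η , c ⟩ ∈ 𝒬 →
                      ⊨ (callQuery {P} R as (callContext {ρ} {σ} {P} {φ} {c} u v R as) ⇒′ ¬′ η)) where

    private
      ψ : Formula S (∣v∣ R)
      ψ = callQuery {P} R as (callContext {ρ} {σ} {P} {φ} {c} u v R as)

      𝒬′ : List Query
      𝒬′ = ⟨ R , ψ , c ⟩ ∷ 𝒬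

      shrinks : ∀ q → Fresh 𝒬′ ρ σ q ⊆ᴾ Fresh 𝒬 ρ σ q
      shrinks _ (fresh prime open″ unasked′) = fresh prime open″ (unasked′ ∘ there)

      -- The new query is satisfiable by `open′` and disjoint from every earlier `η`, so it is
      -- contained in none of them.
      was-fresh : Fresh 𝒬 ρ σ ⟨ P , φ , suc c ⟩ (P , u , pos (call R as) , v)
      was-fresh = fresh prime open′ λ {η} η∈ valid → open′ λ I mod e (hu , hR , hv) hφ →
        let a  = evals (algebra I) e as
            hψ = from (Sat-callQuery I P R as (callContext {ρ} {σ} {P} {φ} {c} u v R as) a) (e , refl , hu , hv , hφ)
        in unasked η η∈ I mod a hψ (valid I mod a hψ)

      not-fresh : ¬ Fresh 𝒬′ ρ σ ⟨ P , φ , suc c ⟩ (P , u , pos (call R as) , v)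
      not-fresh (fresh _ _ unasked′) = unasked′ (here refl) λ I mod a h → h

    query-weight : weight 𝒬′ ρ σ < weight 𝒬 ρ σ
    query-weight = ℕ.≤-trans
      -- The new query is charged as if all its marked paths were fresh; the drop at its parent
      -- exceeds this charge.
      (ℕ.+-monoˡ-≤ (total (queryCost 𝒬′ ρ σ) 𝒬) (s≤s (cost-monotone c (count≤length _ markedPaths))))
      (total-decrease (queryCost-monotone shrinks) (suc (cost c (length markedPaths))) q∈
        (cost-strict c (count-strict (shrinks _) (∈-markedPaths prime) was-fresh not-fresh)))

  -- Runs of RecMC

  -- Falsity at `return SAFE` turns preservation of the invariant into the impossibility of that
  -- verdict.
  ConfigInvariant : Config → Set _
  ConfigInvariant (bounded n (𝒬 ∥ ρ ∥ σ))         = Invariant n 𝒬 ρ σ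
  ConfigInvariant (bounded n (returns UNSAFE ρ σ)) = Lift _ ⊤
  ConfigInvariant (bounded n (returns SAFE ρ σ))   = Sound n ρ σ × Excluded n σ
  ConfigInvariant (return SAFE)                    = Lift _ ⊥
  ConfigInvariant (return UNSAFE)                  = Lift _ ⊤

  bnd-preserves : ∀ {n c c′} → BndSafety n c c′ → ConfigInvariant (bounded n c) → ConfigInvariant (bounded n c′)
  bnd-preserves (sum ψ q∈ _ β⇒ψ _)                       inv = sum-invariant ψ q∈ β⇒ψ inv
  bnd-preserves (reach π q∈ prime _)                     inv = reach-invariant π q∈ prime inv
  bnd-preserves (query u v R as q∈ _ prime blocked _ _)  inv = query-invariant u v R as q∈ blocked inv
  bnd-preserves (unsafe reached)                         inv = lift tt
  bnd-preserves (safe excluded)                          inv = sound inv , excluded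

  -- All facts in `ρ` have bound at most `n`, so they lie inside `O σ (just n)`, which excludes
  -- violations; the new initial query is thus disjoint from them.
  next-round : ∀ {n ρ σ} → Sound n ρ σ → Excluded n σ →
               Invariant (suc n) (⟨ main , ¬′ φ-safe , suc n ⟩ ∷ []) ρ (push σ n)
  next-round {n} {ρ} {σ} snd excluded = init-invariant (push-sound snd) λ I mod a h →
    let c , δ , δ∈ , _ , hδ = to (Sat-U 𝒜 I ρ (suc n) main a) h
    in excluded I mod a (O-sound snd mod (suc n) main
         (iterate-monotone 𝒜 I (s≤s (ρ-bound snd δ∈)) main (ρ-sound snd δ∈ I mod hδ)))

  module _ (unsafe-main : ¬ Safe Th main φ-safe) where

    preserves : ∀ {c c′} → c ⟶ c′ → ConfigInvariant c → ConfigInvariant c′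
    preserves (step st)           inv              = bnd-preserves st inv
    preserves unsafe              _                = lift tt
    preserves (is-inductive ind)  (snd , excluded) = lift (unsafe-main (inductive-safe snd excluded ind))
    preserves (not-inductive _)   (snd , excluded) = next-round snd excluded

    preserves⋆ : ∀ {c c′} → Star _⟶_ c c′ → ConfigInvariant c → ConfigInvariant c′
    preserves⋆ ε        inv = inv
    preserves⋆ (x ◅ xs) inv = preserves⋆ xs (preserves x inv)

    normal-form : ∀ {c} → ConfigInvariant c → IsNormalForm _⟶_ c → c ≡ return UNSAFE
    normal-form {bounded n (𝒬 ∥ ρ ∥ σ)} inv nf = contradiction (_ , step (proj₂ (progress inv))) nf
    normal-form {bounded n (returns UNSAFE ρ σ)} inv nf = contradiction (_ , unsafe) nf
    normal-form {bounded n (returns SAFE ρ σ)} inv nf with em {P = Inductive σ n}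
    ... | yes ind = contradiction (_ , is-inductive ind) nf
    ... | no ¬ind = contradiction (_ , not-inductive ¬ind) nf
    normal-form {return UNSAFE} inv nf = refl

    module _ {N : ℕ} {I : Structure S ℓ} (mod : Model I) {a} (reached : iterate 𝒜 I N main a)
             (¬φ-safe : ¬ Sat I φ-safe a) where

      -- At most k further rounds follow, since SAFE is not returned once n ≥ N.
      mutual
        terminates : ∀ k {n 𝒬 ρ σ} → N ≤ k + n → Invariant n 𝒬 ρ σ →
                     Acc _<_ (rank ρ n) → Acc _<_ (weight 𝒬 ρ σ) →
                     Acc (flip _⟶_) (bounded n (𝒬 ∥ ρ ∥ σ))
        terminates k N≤k+n inv accR accW = acc (successor k N≤k+n inv accR accW)

        successor : ∀ k {n 𝒬 ρ σ} → N ≤ k + n → Invariant n 𝒬 ρ σ →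
                    Acc _<_ (rank ρ n) → Acc _<_ (weight 𝒬 ρ σ) →
                    ∀ {c} → bounded n (𝒬 ∥ ρ ∥ σ) ⟶ c → Acc (flip _⟶_) c
        successor k N≤k+n inv accR (acc accW) (step st@(sum ψ q∈ _ _ ψ⇒¬φ)) =
          terminates k N≤k+n (bnd-preserves st inv) accR (accW (sum-weight ψ q∈ ψ⇒¬φ))
        successor k N≤k+n inv (acc accR) accW (step st@(reach {φ = φ} π q∈ prime new)) =
          terminates k N≤k+n (bnd-preserves st inv)
            -- A new fact may change every freshness count, so the weight starts anew under a
            -- smaller rank.
            (accR (reach-rank {φ = φ} prime (disjoint inv q∈) new (ℕ.≤⇒≤′ (bound≤ inv q∈)))) (<-wellFounded _)
        successor k N≤k+n inv accR (acc accW) (step st@(query u v R as q∈ _ prime _ open′ unasked)) =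
          terminates k N≤k+n (bnd-preserves st inv) accR (accW (query-weight u v R as q∈ prime open′ unasked))
        successor k N≤k+n inv accR accW (step (unsafe _)) = acc λ { unsafe → acc λ () ; (step ()) }
        successor k N≤k+n inv accR accW (step (safe excluded)) = acc λ
          { (is-inductive _)  → acc λ ()
          ; (not-inductive _) → next k N≤k+n (sound inv) excluded
          ; (step ()) }

        next : ∀ k {n ρ σ} → N ≤ k + n → Sound n ρ σ → Excluded n σ →
               Acc (flip _⟶_) (bounded (suc n) (Init (suc n) ρ (push σ n)))
        -- Here `N ≤ n`: the counterexample lies in the iterate of index `suc n`, hence in
        -- `O σ (just n)`, against exclusion.
        next zero    {n} N≤n   snd excluded = contradiction (excluded I mod a
          (O-sound snd mod (suc n) main (iterate-monotone 𝒜 I (ℕ.m≤n⇒m≤1+n N≤n) main reached))) ¬φ-safe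
        next (suc k) {n} N≤k+n snd excluded = terminates k (subst (N ≤_) (sym (ℕ.+-suc k n)) N≤k+n)
          (next-round snd excluded) (<-wellFounded _) (<-wellFounded _)

    start-invariant : ConfigInvariant start
    start-invariant = init-invariant
      (record { ρ-bound = λ () ; σ-bound = λ () ; ρ-sound = λ () ; σ-sound = λ () })
      λ I mod a h → case to (Sat-U 𝒜 I ∅ 0 main a) h of λ { (_ , _ , () , _) }

    returns-unsafe : RecMC-returns UNSAFE
    returns-unsafe =
      let N , I , mod , a , reached , ¬φ = bounded-counterexample Th main φ-safe unsafe-main
      -- Rounds start at 0, so `N` further rounds suffice as the budget.
      in terminates mod reached ¬φ N (ℕ.m≤m+n N 0) start-invariant (<-wellFounded _) (<-wellFounded _) ,
         λ run nf → normal-form (preserves⋆ run start-invariant) nf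

mainTheorem3 : (em : ∀ {a : Level} → ExcludedMiddle a) →
    ∀ {s ℓ t : Level} (S : Signature s) (Th : Theory S ℓ t) (oracle : Oracle Th)
    (𝒜 : Program S) (φ-safe : Formula S (Program.∣v∣ 𝒜 (Program.main 𝒜))) →
    ¬ Semantics.Safe 𝒜 Th (Program.main 𝒜) φ-safe →
    Algorithms.RecMC-returns Th (validityTest Th em oracle) 𝒜 φ-safe UNSAFE
mainTheorem3 em S Th oracle 𝒜 φ-safe =
  Run.returns-unsafe em Th (validityTest Th em oracle) 𝒜 φ-safe
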